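{- Let $q$ be an even prime power and let $L$ be a line of $\mathrm{PG}(5,q)$ in the $K$-orbit $o_{12,3}$. Then the hyperplane-orbit distribution of $L$ is $OD_4(L)=\left[q+1,\,q^2+\frac q2,\,q^2-\frac q2,\,q^3-q^2\right]$.
   Context: A point $(y_0,\dots,y_5)$ of $\mathrm{PG}(5,q)$ is identified with the nonzero symmetric matrix $\begin{bmatrix} y_0&y_1&y_2\\ y_1&y_3&y_4\\ y_2&y_4&y_5\end{bmatrix}$ up to scalar. $K\cong\mathrm{PGL}(3,q)$ acts by $M\mapsto AMA^T$, $A\in\mathrm{GL}(3,q)$. The orbit $o_{12,3}$ (defined only for $q$ even) is the $K$-orbit of the line $\left\{\begin{bmatrix} 0&x&0\\ x&x+y&y\\ 0&y&0\end{bmatrix}:(x,y)\in\mathrm{PG}(1,q)\right\}$. Hyperplanes correspond to conics of $\mathrm{PG}(2,q)$ (nonzero quadratic forms up to scalar): $\sum_{0\le i\le j\le2}a_{ij}X_iX_j$ corresponds to $a_{00}Y_0+a_{01}Y_1+a_{02}Y_2+a_{11}Y_3+a_{12}Y_4+a_{22}Y_5=0$. $\mathcal H_1,\mathcal H_{2,r},\mathcal H_{2,i},\mathcal H_3$ are the sets of hyperplanes corresponding respectively to double lines (scalar multiples of squares of linear forms), pairs of distinct real lines (products of two non-proportional linear forms over $\mathbb F_q$), pairs of conjugate imaginary lines (scalar multiples of products of two non-proportional linear forms conjugate over $\mathbb F_{q^2}$), and non-singular conics (those with $4a_{00}a_{11}a_{22}+a_{01}a_{02}a_{12}-a_{00}a_{12}^2-a_{11}a_{02}^2-a_{22}a_{01}^2\ne0$).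 $OD_4(L)=[h_1,h_{2,r},h_{2,i},h_3]$ lists the numbers of hyperplanes in $\mathcal H_1,\mathcal H_{2,r},\mathcal H_{2,i},\mathcal H_3$ containing $L$. -}

module Defs where

open import Algebra.Bundles using (CommutativeRing; Semiring)
open import Algebra.Morphism.Bundles using (RingHomomorphism)
import Algebra.Definitions
import Algebra.Definitions.RawSemiring
import Relation.Binary.Construct.On as On
import Relation.Binary.Reasoning.Setoid
import Data.Vec.Functional.Relation.Binary.Equality.Setoid
open import Data.Fin.Base using (Fin)
open import Data.Fin.Patterns using (0F; 1F; 2F; 3F; 4F; 5F)
open import Data.Nat.Base as ℕ using (ℕ; suc)
open import Data.Nat.Divisibility using (_∣_)
open import Data.Nat.Primality using (Prime)
open import Data.Product.Base using (Σ; ∃; _×_; _,_; proj₁; proj₂)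
open import Data.Vec.Functional
  using (Vector; []; _∷_; map; zipWith; replicate; transpose)
open import Function.Bundles using (Inverse)
open import Level using (Level; _⊔_) renaming (suc to lsuc)
open import Relation.Binary.Bundles using (Setoid)
open import Relation.Binary.PropositionalEquality as ≡ using (_≡_)
open import Relation.Nullary.Negation.Core using (¬_)
open import Relation.Unary using (Pred; _∈_; _≐_)

PrimePower : ℕ → Set
PrimePower q = ∃ λ p → ∃ λ k → Prime p × 1 ℕ.≤ k × q ≡ p ℕ.^ k

EvenPrimePower : ℕ → Set
EvenPrimePower q = PrimePower q × 2 ∣ q

_HasCardinality_ : ∀ {a ℓ : Level} → Setoid a ℓ → ℕ → Set (a ⊔ ℓ)
S HasCardinality n = Inverse (≡.setoid (Fin n)) S

-- Elements of S satisfying P, compared by the equality of S alone.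
Subsetoid : ∀ {a ℓ p : Level} (S : Setoid a ℓ) → Pred (Setoid.Carrier S) p → Setoid (a ⊔ p) ℓ
Subsetoid S P = On.setoid {B = Σ (Setoid.Carrier S) P} S proj₁

-- Discrete rather than Heyting fields: the fields used here are finite, so
-- equality is decidable and an apartness relation would carry no information.
record Field (c ℓ : Level) : Set (lsuc (c ⊔ ℓ)) where
  field
    commutativeRing : CommutativeRing c ℓ
  open CommutativeRing commutativeRing public
  open Algebra.Definitions _≈_ using (Invertible)
  field
    1≉0        : ¬ (1# ≈ 0#)
    invertible : ∀ x → ¬ (x ≈ 0#) → Invertible 1# _*_ x

module LinearAlgebra {c ℓ : Level} (R : CommutativeRing c ℓ) where
  open CommutativeRing R
  open Algebra.Definitions.RawSemiring (Semiring.rawSemiring semiring) using (sum)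
  open Data.Vec.Functional.Relation.Binary.Equality.Setoid setoid public
    using (_≋_)

  infixl 6 _+ᵥ_
  infixr 7 _*ᵥ_
  infix  7 _·_

  0ᵥ : ∀ {n} → Vector Carrier n
  0ᵥ = replicate _ 0#

  _+ᵥ_ : ∀ {n} → Vector Carrier n → Vector Carrier n → Vector Carrier n
  _+ᵥ_ = zipWith _+_

  _*ᵥ_ : ∀ {n} → Carrier → Vector Carrier n → Vector Carrier n
  x *ᵥ v = map (x *_) v

  _·_ : ∀ {n} → Vector Carrier n → Vector Carrier n → Carrier
  u · v = sum (zipWith _*_ u v)

  Matrix : ℕ → Set c
  Matrix n = Vector (Vector Carrier n) n

  infix  4 _≈ᴹ_
  infixl 7 _*ᴹ_

  _≈ᴹ_ : ∀ {n} → Matrix n → Matrix n → Set ℓ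
  M ≈ᴹ N = ∀ i → M i ≋ N i

  _*ᴹ_ : ∀ {n} → Matrix n → Matrix n → Matrix n
  (M *ᴹ N) i j = M i · transpose N j

  scaleᴹ : ∀ {n} → Carrier → Matrix n → Matrix n
  scaleᴹ x = map (x *ᵥ_)

  1ᴹ : ∀ {n} → Matrix n
  1ᴹ 0F              0F              = 1#
  1ᴹ 0F              (Fin.suc j)     = 0#
  1ᴹ (Fin.suc i)     0F              = 0#
  1ᴹ (Fin.suc i)     (Fin.suc j)     = 1ᴹ i j

  GL : ∀ {n} → Pred (Matrix n) (c ⊔ ℓ)
  GL = Invertible 1ᴹ _*ᴹ_
    where open Algebra.Definitions _≈ᴹ_ using (Invertible)

  symmetricMatrix : Vector Carrier 6 → Matrix 3
  symmetricMatrix y =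
    (y 0F ∷ y 1F ∷ y 2F ∷ []) ∷
    (y 1F ∷ y 3F ∷ y 4F ∷ []) ∷
    (y 2F ∷ y 4F ∷ y 5F ∷ []) ∷ []

  -- A ternary quadratic form is its coefficient vector
  -- (a₀₀, a₀₁, a₀₂, a₁₁, a₁₂, a₂₂), with cross terms not halved;
  -- u ⊗ v is the product of the linear forms Σ uᵢXᵢ and Σ vᵢXᵢ.
  _⊗_ : Vector Carrier 3 → Vector Carrier 3 → Vector Carrier 6
  u ⊗ v =
    u 0F * v 0F ∷
    u 0F * v 1F + u 1F * v 0F ∷
    u 0F * v 2F + u 2F * v 0F ∷
    u 1F * v 1F ∷
    u 1F * v 2F + u 2F * v 1F ∷
    u 2F * v 2F ∷ []

module Projective {c ℓ : Level} (F : Field c ℓ) where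
  open Field F
  open LinearAlgebra commutativeRing
  private
    module ≈-Reasoning = Relation.Binary.Reasoning.Setoid setoid

  Nonzero : ∀ {n} → Pred (Vector Carrier n) ℓ
  Nonzero v = ¬ (v ≋ 0ᵥ)

  infix 4 _∼_
  _∼_ : ∀ {n} → Vector Carrier n → Vector Carrier n → Set (c ⊔ ℓ)
  v ∼ w = ∃ λ x → ¬ (x ≈ 0#) × v ≋ x *ᵥ w

  ∼-refl : ∀ {n} {v : Vector Carrier n} → v ∼ v
  ∼-refl = 1# , 1≉0 , λ i → sym (*-identityˡ _)

  ∼-sym : ∀ {n} {v w : Vector Carrier n} → v ∼ w → w ∼ v
  ∼-sym {v = v} {w} (x , x≉0 , v≋xw) = y , y≉0 , λ i → begin
      w i            ≈⟨ *-identityˡ (w i) ⟨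
      1# * w i       ≈⟨ *-congʳ yx≈1 ⟨
      y * x * w i    ≈⟨ *-assoc y x (w i) ⟩
      y * (x * w i)  ≈⟨ *-congˡ (v≋xw i) ⟨
      y * v i        ∎
    where
    open ≈-Reasoning
    y : Carrier
    y = proj₁ (invertible x x≉0)
    yx≈1 : y * x ≈ 1#
    yx≈1 = proj₁ (proj₂ (invertible x x≉0))
    y≉0 : ¬ (y ≈ 0#)
    y≉0 y≈0 = 1≉0 (trans (sym yx≈1) (trans (*-congʳ y≈0) (zeroˡ x)))

  ∼-trans : ∀ {n} {u v w : Vector Carrier n} → u ∼ v → v ∼ w → u ∼ w
  ∼-trans {u = u} {v} {w} (x , x≉0 , u≋xv) (y , y≉0 , v≋yw) =
    x * y , xy≉0 , λ i → trans (u≋xv i) (trans (*-congˡ (v≋yw i)) (sym (*-assoc x y (w i))))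
    where
    open ≈-Reasoning
    x⁻¹ : Carrier
    x⁻¹ = proj₁ (invertible x x≉0)
    xy≉0 : ¬ (x * y ≈ 0#)
    xy≉0 xy≈0 = y≉0 (begin
      y              ≈⟨ *-identityˡ y ⟨
      1# * y         ≈⟨ *-congʳ (proj₁ (proj₂ (invertible x x≉0))) ⟨
      x⁻¹ * x * y    ≈⟨ *-assoc x⁻¹ x y ⟩
      x⁻¹ * (x * y)  ≈⟨ *-congˡ xy≈0 ⟩
      x⁻¹ * 0#       ≈⟨ zeroʳ x⁻¹ ⟩
      0#             ∎)

  PG : ℕ → Setoid (c ⊔ ℓ) (c ⊔ ℓ)
  PG n = record
    { Carrier       = Σ (Vector Carrier (suc n)) Nonzero
    ; _≈_           = λ p r → proj₁ p ∼ proj₁ r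
    ; isEquivalence = record { refl = ∼-refl ; sym = ∼-sym ; trans = ∼-trans }
    }

  Point : ℕ → Set (c ⊔ ℓ)
  Point n = Setoid.Carrier (PG n)

  coords : ∀ {n} → Point n → Vector Carrier (suc n)
  coords = proj₁

  record Line (n : ℕ) : Set (c ⊔ ℓ) where
    field
      P Q      : Point n
      distinct : ¬ (coords P ∼ coords Q)

  points : ∀ {n} → Line n → Pred (Point n) (c ⊔ ℓ)
  points L p = ∃ λ x → ∃ λ y → coords p ≋ x *ᵥ coords P +ᵥ y *ᵥ coords Q
    where open Line L

  -- The image of a set of points of PG(5,q) under M ↦ A M Aᵀ.
  Image : ∀ {s : Level} → Matrix 3 → Pred (Point 5) s → Pred (Point 5) (c ⊔ ℓ ⊔ s)
  Image A S p = ∃ λ z → z ∈ S × ∃ λ x → ¬ (x ≈ 0#) ×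
    symmetricMatrix (coords p) ≈ᴹ
      scaleᴹ x (A *ᴹ symmetricMatrix (coords z) *ᴹ transpose A)

  -- The points with matrix [0 x 0; x x+y y; 0 y 0], (x,y) ∈ PG(1,q).
  representative₁₂,₃ : Pred (Point 5) (c ⊔ ℓ)
  representative₁₂,₃ z = ∃ λ (w : Point 1) →
    let x = coords w 0F ; y = coords w 1F in
    coords z ∼ (0# ∷ x ∷ 0# ∷ x + y ∷ y ∷ 0# ∷ [])

  o₁₂,₃ : Pred (Line 5) (c ⊔ ℓ)
  o₁₂,₃ L = ∃ λ A → A ∈ GL × points L ≐ Image A representative₁₂,₃

  -- A hyperplane of PG(5,q) is its dual coordinate vector, which is also the
  -- coefficient vector of the corresponding conic of PG(2,q).
  Hyperplane : Set (c ⊔ ℓ)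
  Hyperplane = Point 5

  Contains : Line 5 → Pred Hyperplane (c ⊔ ℓ)
  Contains L H = ∀ p → p ∈ points L → coords H · coords p ≈ 0#

  H₁ : Pred Hyperplane (c ⊔ ℓ)
  H₁ H = ∃ λ x → ∃ λ u → coords H ≋ x *ᵥ (u ⊗ u)

  H₂ᵣ : Pred Hyperplane (c ⊔ ℓ)
  H₂ᵣ H = ∃ λ (u : Point 2) → ∃ λ (v : Point 2) →
    ¬ (coords u ∼ coords v) × coords H ≋ coords u ⊗ coords v

  H₃ : Pred Hyperplane ℓ
  H₃ H = ¬ (4 ×ₙ (a₀₀ * a₁₁ * a₂₂) + a₀₁ * a₀₂ * a₁₂
            - a₀₀ * (a₁₂ * a₁₂) - a₁₁ * (a₀₂ * a₀₂) - a₂₂ * (a₀₁ * a₀₁) ≈ 0#)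
    where
    open Algebra.Definitions.RawSemiring (Semiring.rawSemiring semiring) using () renaming (_×_ to _×ₙ_)
    a₀₀ a₀₁ a₀₂ a₁₁ a₁₂ a₂₂ : Carrier
    a₀₀ = coords H 0F
    a₀₁ = coords H 1F
    a₀₂ = coords H 2F
    a₁₁ = coords H 3F
    a₁₂ = coords H 4F
    a₂₂ = coords H 5F

-- q is the order of F, E the field of order q², and ι the embedding of F in E,
-- so that conjugation of E over F is x ↦ x^q.
module HyperplaneOrbits {c ℓ c′ ℓ′ : Level} (q : ℕ)
  (F : Field c ℓ) (E : Field c′ ℓ′)
  (ι : RingHomomorphism (Field.rawRing F) (Field.rawRing E)) where
  open Projective F
  private
    module F = Field F
    module E where
      open Field E public
      open LinearAlgebra commutativeRing public
      open Projective E public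
      open Algebra.Definitions.RawSemiring (Semiring.rawSemiring semiring) public using (_^_)
  open RingHomomorphism ι using (⟦_⟧)

  conjugate : ∀ {n} → Vector E.Carrier n → Vector E.Carrier n
  conjugate = map (E._^ q)

  H₂ᵢ : Pred Hyperplane (c ⊔ c′ ⊔ ℓ′)
  H₂ᵢ H = ∃ λ (x : F.Carrier) → ∃ λ (u : E.Point 2) →
    ¬ (E.coords u E.∼ conjugate (E.coords u)) ×
    map ⟦_⟧ (coords H) E.≋ ⟦ x ⟧ E.*ᵥ (E.coords u E.⊗ conjugate (E.coords u))

  NumberContaining : ∀ {h : Level} → Line 5 → Pred Hyperplane h → ℕ → Set (c ⊔ ℓ ⊔ h)
  NumberContaining L 𝓗 n =
    Subsetoid (PG 5) (λ H → H ∈ 𝓗 × H ∈ Contains L) HasCardinality n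

  -- OD₄(L) = [h₁, h₂ᵣ, h₂ᵢ, h₃]
  record OD₄[_]=[_,_,_,_] (L : Line 5) (h₁ h₂ᵣ h₂ᵢ h₃ : ℕ) : Set (c ⊔ ℓ ⊔ c′ ⊔ ℓ′) where
    field
      number₁  : NumberContaining L H₁  h₁
      number₂ᵣ : NumberContaining L H₂ᵣ h₂ᵣ
      number₂ᵢ : NumberContaining L H₂ᵢ h₂ᵢ
      number₃  : NumberContaining L H₃  h₃

{-# OPTIONS --safe #-}

-- The substitution f ↦ f(AX) is adjoint to M ↦ AMAᵀ, so it preserves the four
-- classes and carries the hyperplanes through a line of o₁₂,₃ to the forms orthogonal
-- to the representative, namely those with a₀₁ = a₁₁ = a₁₂ = c, say.  Writing a, b, d
-- for a₀₀, a₀₂, a₂₂, such a form is up to a scalar a double line (b = c = 0), or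
-- aX² + XZ + dZ² (c = 0, b = 1), or else, for c = 1 and e = a + b² + b + d,
--   V² + UV + dU² + eX²  where U = X + Z and V = Y + bX.
-- The discriminant of the last form is e, so it is non-singular exactly for e ≠ 0.
-- The second form, and the third for e = 0, splits over F exactly when ad,
-- respectively d, is of the form t² + t.  The map ℘ t = t² + t is two-to-one, so
-- half the elements of F are of this form, and every other y ∈ F is ℘ s for some
-- s ∈ E with conjugate s + 1, which provides the two conjugate factors.
module Submission where

open import Defs
open import Algebra.Bundles using (CommutativeRing; Semiring)
import Algebra.Definitions.RawSemiring
open import Algebra.Morphism.Bundles using (RingHomomorphism)
import Algebra.Properties.CommutativeMonoid.Sum
import Algebra.Properties.CommutativeSemigroup
import Algebra.Properties.CommutativeSemiring.Exp
import Algebra.Properties.Group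
import Algebra.Properties.Ring
import Algebra.Properties.Semiring.Mult
import Algebra.Properties.Semiring.Sum
import Algebra.Solver.Ring
open import Algebra.Solver.Ring.AlmostCommutativeRing using (fromCommutativeRing; _-Raw-AlmostCommutative⟶_)
open import Data.Bool.Base using (Bool; true; false)
open import Data.Bool.Properties using (xor-∧-commutativeRing) renaming (_≟_ to _≟ᵇ_)
open import Data.Empty.Polymorphic using (⊥)
open import Data.Fin.Base using (Fin; zero; suc; inject≤)
open import Data.Fin.Patterns using (0F; 1F; 2F; 3F; 4F; 5F)
open import Data.Fin.Permutation using (Permutation; ↔⇒≡)
open import Data.Fin.Properties as Fin using (+↔⊎; *↔×; 1↔⊤; <⇒notInjective)
open import Data.Maybe.Base as Maybe using (Maybe)
open import Data.Nat.Base as ℕ using (ℕ; zero; suc; _≤_; s≤s; z≤n)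
open import Data.Nat.Divisibility using (_∣_; ∣1⇒≡1)
open import Data.Nat.DivMod using (m*n/n≡m)
open import Data.Nat.Primality using (prime[2]; euclidsLemma; prime⇒irreducible)
import Data.Nat.Properties as ℕ
open import Data.Nat.Solver using (module +-*-Solver)
open import Data.Product.Base using (∃; _×_; _,_; proj₁; proj₂)
open import Data.Product.Function.NonDependent.Setoid using (_×-inverse_)
open import Data.Product.Relation.Binary.Pointwise.NonDependent as ×ₚ using (_×ₛ_)
open import Data.Sum.Base using (_⊎_; inj₁; inj₂; [_,_]′)
open import Data.Sum.Function.Setoid using (_⊎-inverse_)
open import Data.Sum.Relation.Binary.Pointwise as ⊎ₚ using (_⊎ₛ_; inj₁; inj₂)
open import Data.Unit.Base using (⊤; tt)
import Data.Unit.Polymorphic as Polymorphic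
open import Data.Vec.Base as Vec using (Vec)
open import Data.Vec.Functional using (Vector; []; _∷_; foldr; map; replicate; transpose; zipWith)
open import Function.Base using (_∘_)
open import Function.Bundles using (Inverse; Injection)
open import Function.Definitions using (Congruent; Injective; StrictlySurjective)
open import Function.Properties.Bijection using (Bijection⇒Inverse)
import Function.Properties.Inverse as Inverseₚ
open import Level using (Level; _⊔_; 0ℓ)
open import Relation.Binary.Bundles using (Setoid)
open import Relation.Binary.Definitions using (_Respects_) renaming (Decidable to Decidable₂)
open import Relation.Binary.PropositionalEquality as ≡ using (_≡_)
import Relation.Binary.Reasoning.Setoid
open import Relation.Nullary.Decidable using (Dec; yes; no; map′; decidable-stable; dec⇒maybe; ¬?)
open import Relation.Nullary.Negation using (¬_; contradiction)
open import Relation.Unary using (Pred; Decidable; _∈_; _≐_)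

-- Cardinalities of setoids

-- Splitting is decided by the Artin-Schreier map because of the following: in a product of two
-- linear forms with mixed coefficient 1, that coefficient is the sum of two terms whose product y
-- is the product of the two outer coefficients, so each term is a root of T² + T + y. For a
-- factorisation over `F` the roots lie in `F`. For a conjugate pair the two terms are s and `σ s`
-- with s + `σ s` = 1, which keeps s out of `F`.
--
-- The numbers arise as follows. That ad is outside the image of `℘` forces a ≠ 0 and happens for (q
-- - 1)q/2 pairs (a, d); the forms with e = 0 contribute q · q/2 to either class of line pairs. The
-- sum is q² - q/2 for the imaginary pairs. The surplus of q real pairs is due to a = 0, where ad =
-- 0 = `℘ 0#` whatever d is.
--
-- `E` is an arbitrary field of order q² with a homomorphism from `F`. That x ↦ x^q is nontrivial on
-- `E` and fixes nothing outside the image of `F` is therefore derived by counting roots of x^q + x.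

module Cardinality where
  private variable
    a b p r ℓ₁ ℓ₂ : Level
    m n : ℕ
    S : Setoid a ℓ₁
    T : Setoid b ℓ₂

  module _ {S : Setoid a ℓ₁} {T : Setoid b ℓ₂} where
    private
      module S = Setoid S
      module T = Setoid T

    bijection⇒inverse : (f : S.Carrier → T.Carrier) → Congruent S._≈_ T._≈_ f →
      Injective S._≈_ T._≈_ f → StrictlySurjective T._≈_ f → Inverse S T
    bijection⇒inverse f cong injective surjective = Bijection⇒Inverse record
      { to        = f
      ; cong      = cong
      ; bijective = injective , λ y → proj₁ (surjective y) , λ z≈x → T.trans (cong z≈x) (proj₂ (surjective y))
      }

    cardinality-↔ : Inverse S T → S HasCardinality n → T HasCardinality n
    cardinality-↔ S↔T |S| = Inverseₚ.trans |S| S↔T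

    cardinality-⊎ : S HasCardinality m → T HasCardinality n → (S ⊎ₛ T) HasCardinality (m ℕ.+ n)
    cardinality-⊎ |S| |T| = Inverseₚ.trans +↔⊎
      (Inverseₚ.trans (Inverseₚ.sym (⊎ₚ.Pointwise-≡↔≡ _ _)) (|S| ⊎-inverse |T|))

    cardinality-× : S HasCardinality m → T HasCardinality n → (S ×ₛ T) HasCardinality (m ℕ.* n)
    cardinality-× |S| |T| = Inverseₚ.trans *↔×
      (Inverseₚ.trans (Inverseₚ.sym ×ₚ.Pointwise-≡↔≡) (|S| ×-inverse |T|))

  cardinality-unique : S HasCardinality m → S HasCardinality n → m ≡ n
  cardinality-unique |S| |S|′ = ↔⇒≡ (Inverseₚ.trans |S| (Inverseₚ.sym |S|′))

  cardinality-⊤ : ≡.setoid ⊤ HasCardinality 1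
  cardinality-⊤ = 1↔⊤

  subset-↔ : {S : Setoid a ℓ₁} {T : Setoid b ℓ₂} (I : Inverse S T) {P : Pred (Setoid.Carrier T) p} →
             P Respects Setoid._≈_ T → Inverse (Subsetoid S (P ∘ Inverse.to I)) (Subsetoid T P)
  subset-↔ {S = S} {T = T} I resp = bijection⇒inverse (λ (x , Px) → to x , Px) to-cong
    (Injection.injective (Inverseₚ.Inverse⇒Injection I))
    λ (y , Py) → (from y , resp (Setoid.sym T (strictlyInverseˡ y)) Py) , strictlyInverseˡ y
    where open Inverse I

  module _ {S : Setoid a ℓ₁} where
    open Setoid S

    cardinality-∅ : {P : Pred Carrier p} → (∀ x → ¬ P x) → Subsetoid S P HasCardinality 0
    cardinality-∅ ∉P = bijection⇒inverse (λ ()) (λ { {()} }) (λ { {()} }) λ (x , Px) → contradiction Px (∉P x)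

    cardinality-subset-U : {P : Pred Carrier p} → (∀ x → P x) → S HasCardinality n → Subsetoid S P HasCardinality n
    cardinality-subset-U ∈P = cardinality-↔
      (bijection⇒inverse (λ x → x , ∈P x) (λ x≈y → x≈y) (λ x≈y → x≈y) λ (x , _) → x , refl)

    cardinality-subset-≐ : {P : Pred Carrier p} {Q : Pred Carrier r} → P ≐ Q →
      Subsetoid S P HasCardinality n → Subsetoid S Q HasCardinality n
    cardinality-subset-≐ (P⊆Q , Q⊆P) = cardinality-↔
      (bijection⇒inverse (λ (x , Px) → x , P⊆Q Px) (λ x≈y → x≈y) (λ x≈y → x≈y) λ (x , Qx) → (x , Q⊆P Qx) , refl)

    partition-cardinality : {P : Pred Carrier p} → P Respects _≈_ → Decidable P → ∀ {k} → S HasCardinality n →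
      Subsetoid S P HasCardinality m → Subsetoid S (¬_ ∘ P) HasCardinality k → m ℕ.+ k ≡ n
    partition-cardinality {P = P} resp P? |S| |P| |¬P| = cardinality-unique
      (cardinality-↔ (bijection⇒inverse to cong injective surjective) (cardinality-⊎ |P| |¬P|)) |S|
      where
      Parts = Subsetoid S P ⊎ₛ Subsetoid S (¬_ ∘ P)
      to : Setoid.Carrier Parts → Carrier
      to (inj₁ (x , _)) = x
      to (inj₂ (x , _)) = x
      cong : Congruent (Setoid._≈_ Parts) _≈_ to
      cong (inj₁ x≈y) = x≈y
      cong (inj₂ x≈y) = x≈y
      injective : Injective (Setoid._≈_ Parts) _≈_ to
      injective {inj₁ _}        {inj₁ _}        x≈y = inj₁ x≈y
      injective {inj₁ (_ , Px)} {inj₂ (_ , ¬Py)} x≈y = contradiction (resp x≈y Px) ¬Py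
      injective {inj₂ (_ , ¬Px)} {inj₁ (_ , Py)} x≈y = contradiction (resp (sym x≈y) Py) ¬Px
      injective {inj₂ _}        {inj₂ _}        x≈y = inj₂ x≈y
      surjective : StrictlySurjective _≈_ to
      surjective x with P? x
      ... | yes Px = inj₁ (x , Px) , refl
      ... | no ¬Px = inj₂ (x , ¬Px) , refl

  module _ {S : Setoid a ℓ₁} {T : Setoid b ℓ₂} where
    private
      module S = Setoid S
      module T = Setoid T

    cardinality-subset-⊎ : {P : Pred (S.Carrier ⊎ T.Carrier) p} →
      Subsetoid S (P ∘ inj₁) HasCardinality m → Subsetoid T (P ∘ inj₂) HasCardinality n →
      Subsetoid (S ⊎ₛ T) P HasCardinality (m ℕ.+ n)
    cardinality-subset-⊎ {P = P} |P₁| |P₂| = cardinality-↔ subset-⊎ (cardinality-⊎ |P₁| |P₂|)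
      where
      subset-⊎ : Inverse (Subsetoid S (P ∘ inj₁) ⊎ₛ Subsetoid T (P ∘ inj₂)) (Subsetoid (S ⊎ₛ T) P)
      subset-⊎ = bijection⇒inverse
        (λ { (inj₁ (x , Px)) → inj₁ x , Px ; (inj₂ (y , Py)) → inj₂ y , Py })
        (λ { (inj₁ x≈y) → inj₁ x≈y ; (inj₂ x≈y) → inj₂ x≈y })
        (λ { {inj₁ _} {inj₁ _} (inj₁ x≈y) → inj₁ x≈y ; {inj₂ _} {inj₂ _} (inj₂ x≈y) → inj₂ x≈y })
        (λ { (inj₁ x , Px) → inj₁ (x , Px) , inj₁ S.refl ; (inj₂ y , Py) → inj₂ (y , Py) , inj₂ T.refl })

    cardinality-subset-× : {P : Pred S.Carrier p} {Q : Pred T.Carrier r} →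
      Subsetoid S P HasCardinality m → Subsetoid T Q HasCardinality n →
      Subsetoid (S ×ₛ T) (λ (x , y) → P x × Q y) HasCardinality (m ℕ.* n)
    cardinality-subset-× {P = P} {Q} |P| |Q| = cardinality-↔ subset-× (cardinality-× |P| |Q|)
      where
      subset-× : Inverse (Subsetoid S P ×ₛ Subsetoid T Q) (Subsetoid (S ×ₛ T) λ (x , y) → P x × Q y)
      subset-× = bijection⇒inverse (λ ((x , Px) , (y , Qy)) → (x , y) , Px , Qy) (λ x≈y → x≈y) (λ x≈y → x≈y)
        λ ((x , y) , Px , Qy) → ((x , Px) , (y , Qy)) , S.refl , T.refl

  Fin-subset-cardinality : ∀ n {P : Pred (Fin n) p} → Decidable P →
                           ∃ λ k → Subsetoid (≡.setoid (Fin n)) P HasCardinality k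
  Fin-subset-cardinality zero    P? = 0 , cardinality-∅ λ ()
  Fin-subset-cardinality (suc n) {P} P? with Fin-subset-cardinality n (P? ∘ suc)
  ... | k , |P∘suc| = _ , cardinality-↔ (subset-↔ ⊤⊎Fin↔Fin (≡.subst P)) (cardinality-subset-⊎ (proj₂ |P0|) |P∘suc|)
    where
    cons : ⊤ ⊎ Fin n → Fin (suc n)
    cons (inj₁ tt) = zero
    cons (inj₂ i)  = suc i
    ⊤⊎Fin↔Fin : Inverse (≡.setoid ⊤ ⊎ₛ ≡.setoid (Fin n)) (≡.setoid (Fin (suc n)))
    ⊤⊎Fin↔Fin = bijection⇒inverse cons
      (λ { (inj₁ _) → ≡.refl ; (inj₂ ≡.refl) → ≡.refl })
      (λ { {inj₁ _} {inj₁ _} _ → inj₁ ≡.refl ; {inj₂ _} {inj₂ _} ≡.refl → inj₂ ≡.refl })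
      (λ { zero → inj₁ tt , ≡.refl ; (suc i) → inj₂ i , ≡.refl })
    |P0| : ∃ λ l → Subsetoid (≡.setoid ⊤) (λ _ → P zero) HasCardinality l
    |P0| with P? zero
    ... | yes P0 = 1 , cardinality-subset-U (λ _ → P0) cardinality-⊤
    ... | no ¬P0 = 0 , cardinality-∅ (λ _ → ¬P0)

  module Finite {S : Setoid a ℓ₁} (|S| : S HasCardinality n) where
    open Setoid S
    open Inverse |S| public using () renaming (to to element; from to index)
    open Inverse |S| using (from-cong; strictlyInverseˡ; strictlyInverseʳ)

    element-index : ∀ x → element (index x) ≈ x
    element-index = strictlyInverseˡ

    index-injective : ∀ {x y} → index x ≡ index y → x ≈ y
    index-injective {x} {y} eq = trans (sym (element-index x))
      (trans (reflexive (≡.cong element eq)) (element-index y))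

    element-injective : ∀ {i j} → element i ≈ element j → i ≡ j
    element-injective {i} {j} eq =
      ≡.trans (≡.sym (strictlyInverseʳ i)) (≡.trans (from-cong eq) (strictlyInverseʳ j))

    infix 4 _≟_
    _≟_ : Decidable₂ _≈_
    x ≟ y = map′ index-injective from-cong (index x Fin.≟ index y)

    any? : {P : Pred Carrier p} → P Respects _≈_ → Decidable P → Dec (∃ P)
    any? resp P? = map′ (λ (i , Pi) → element i , Pi)
      (λ (x , Px) → index x , resp (sym (element-index x)) Px) (Fin.any? (P? ∘ element))

    subset-cardinality : {P : Pred Carrier p} → P Respects _≈_ → Decidable P →
                         ∃ λ k → Subsetoid S P HasCardinality k
    subset-cardinality resp P? with Fin-subset-cardinality n (P? ∘ element)
    ... | k , |P| = k , cardinality-↔ (subset-↔ |S| resp) |P|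

    -- The complement has some cardinality because it is decidable; the partition then forces the
    -- value.
    complement-cardinality : {P : Pred Carrier p} → P Respects _≈_ → Decidable P →
      Subsetoid S P HasCardinality m → Subsetoid S (¬_ ∘ P) HasCardinality (n ℕ.∸ m)
    complement-cardinality {m = m} {P = P} resp P? |P|
      with k , |¬P| ← subset-cardinality {P = ¬_ ∘ P} (λ x≈y ¬Px Py → ¬Px (resp (sym x≈y) Py)) (λ x → ¬? (P? x))
      = ≡.subst (Subsetoid S (¬_ ∘ P) HasCardinality_)
          (≡.trans (≡.sym (ℕ.m+n∸m≡n m k)) (≡.cong (ℕ._∸ m) (partition-cardinality resp P? |S| |P| |¬P|))) |¬P|

  module _ {S : Setoid a ℓ₁} {T : Setoid b ℓ₂} (|S| : S HasCardinality m) (|T| : T HasCardinality n)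
    {f : Setoid.Carrier S → Setoid.Carrier T}
    (cong : Congruent (Setoid._≈_ S) (Setoid._≈_ T) f) (injective : Injective (Setoid._≈_ S) (Setoid._≈_ T) f) where
    private
      module S where
        open Setoid S public
        open Finite |S| public
      module T where
        open Setoid T public
        open Finite |T| public

    -- Pigeonhole: a missed y, put in front of the values of f, would inject m + 1 elements into n ≤
    -- m.
    injection⇒surjection : n ≤ m → StrictlySurjective T._≈_ f
    injection⇒surjection n≤m y
      with S.any? {P = λ x → f x T.≈ y} (λ x≈x′ fx≈y → T.trans (cong (S.sym x≈x′)) fx≈y) (λ x → f x T.≟ y)
    ... | yes y∈f = y∈f
    ... | no  y∉f = contradiction (λ {i j} → g-injective {i} {j}) (<⇒notInjective {f = g} (ℕ.s≤s n≤m))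
      where
      g : Fin (suc m) → Fin n
      g zero    = T.index y
      g (suc i) = T.index (f (S.element i))
      g-injective : ∀ {i j} → g i ≡ g j → i ≡ j
      g-injective {zero}  {zero}  _  = ≡.refl
      g-injective {zero}  {suc j} eq = contradiction (S.element j , T.sym (T.index-injective eq)) y∉f
      g-injective {suc i} {zero}  eq = contradiction (S.element i , T.index-injective eq) y∉f
      g-injective {suc i} {suc j} eq = ≡.cong suc (S.element-injective (injective (T.index-injective eq)))

open Cardinality

-- Ternary quadratic forms in characteristic two

HasCharacteristicTwo : ∀ {c ℓ} → CommutativeRing c ℓ → Set ℓ
HasCharacteristicTwo R = 1# + 1# ≈ 0#
  where open CommutativeRing R

module CharacteristicTwo {c ℓ : Level} (R : CommutativeRing c ℓ)
  (1+1≈0 : HasCharacteristicTwo R) where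
  open CommutativeRing R hiding (zero)
  open Algebra.Properties.Ring ring using (-0#≈0#; +-inverseˡ-unique)
  open LinearAlgebra R
  open Algebra.Definitions.RawSemiring (Semiring.rawSemiring semiring) using (sum) renaming (_×_ to _×ₙ_)

  private
    scalar : Bool → Carrier
    scalar false = 0#
    scalar true  = 1#

    -- Coefficients in the two-element field make the ring solver decide
    -- identities that only hold in characteristic two.
    scalar-homomorphism : CommutativeRing.rawRing xor-∧-commutativeRing
                          -Raw-AlmostCommutative⟶ fromCommutativeRing R
    scalar-homomorphism = record
      { ⟦_⟧    = scalar
      ; +-homo = λ { false _ → sym (+-identityˡ _)
                   ; true false → sym (+-identityʳ _)
                   ; true true → sym 1+1≈0 }
      ; *-homo = λ { false _ → sym (zeroˡ _) ; true _ → sym (*-identityˡ _) }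
      ; -‿homo = λ { false → sym -0#≈0# ; true → +-inverseˡ-unique 1# 1# 1+1≈0 }
      ; 0-homo = refl
      ; 1-homo = refl
      }

    scalar-≟ : ∀ x y → Maybe (scalar x ≈ scalar y)
    scalar-≟ x y = Maybe.map (λ { ≡.refl → refl }) (dec⇒maybe (x ≟ᵇ y))

  open Algebra.Solver.Ring (CommutativeRing.rawRing xor-∧-commutativeRing)
    (fromCommutativeRing R) scalar-homomorphism scalar-≟
    using (solve; Polynomial; _:=_; _:+_; _:*_; _:-_; con) public
  open Algebra.Properties.CommutativeMonoid.Sum +-commutativeMonoid
    using (sum-cong-≋; ∑-comm)
  open Algebra.Properties.Semiring.Sum semiring using (*-distribˡ-sum; *-distribʳ-sum)
  open Relation.Binary.Reasoning.Setoid setoid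

  x+x≈0 : ∀ x → x + x ≈ 0#
  x+x≈0 = solve 1 (λ x → x :+ x := con false) refl

  x+y≈0⇒x≈y : ∀ {x y} → x + y ≈ 0# → x ≈ y
  x+y≈0⇒x≈y {x} {y} x+y≈0 = begin
    x            ≈⟨ solve 2 (λ x y → x := (x :+ y) :+ y) refl x y ⟩
    (x + y) + y  ≈⟨ +-congʳ x+y≈0 ⟩
    0# + y       ≈⟨ +-identityˡ y ⟩
    y            ∎

  ·-cong : ∀ {n} {u u′ v v′ : Vector Carrier n} → u ≋ u′ → v ≋ v′ → u · v ≈ u′ · v′
  ·-cong u≋u′ v≋v′ = sum-cong-≋ λ i → *-cong (u≋u′ i) (v≋v′ i)

  ·-*ᵥ : ∀ {n} (u : Vector Carrier n) x v → u · (x *ᵥ v) ≈ x * (u · v)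
  ·-*ᵥ u x v = begin
    u · (x *ᵥ v)                 ≈⟨ sum-cong-≋ (λ i → x∙yz≈y∙xz (u i) x (v i)) ⟩
    sum (λ i → x * (u i * v i))  ≈⟨ *-distribˡ-sum x (zipWith _*_ u v) ⟨
    x * (u · v)                  ∎
    where open Algebra.Properties.CommutativeSemigroup *-commutativeSemigroup using (x∙yz≈y∙xz)

  *ᵥ-· : ∀ {n} x (u : Vector Carrier n) v → (x *ᵥ u) · v ≈ x * (u · v)
  *ᵥ-· x u v = begin
    (x *ᵥ u) · v                 ≈⟨ sum-cong-≋ (λ i → *-assoc x (u i) (v i)) ⟩
    sum (λ i → x * (u i * v i))  ≈⟨ *-distribˡ-sum x (zipWith _*_ u v) ⟨
    x * (u · v)                  ∎

  infixl 7 _ᵥ*_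
  _ᵥ*_ : ∀ {m n} → Vector Carrier m → Vector (Vector Carrier n) m → Vector Carrier n
  (u ᵥ* M) j = u · transpose M j

  -- Associativity of row times matrix times column, by exchanging the sums. The adjunction with M ↦
  -- AMAᵀ and the composition of substitutions both rest on it.
  ᵥ*-· : ∀ {m n} (u : Vector Carrier m) (M : Vector (Vector Carrier n) m) v →
         (u ᵥ* M) · v ≈ u · λ i → M i · v
  ᵥ*-· u M v = begin
    sum (λ j → sum (λ i → u i * M i j) * v j)
      ≈⟨ sum-cong-≋ (λ j → *-distribʳ-sum (v j) (λ i → u i * M i j)) ⟩
    sum (λ j → sum (λ i → u i * M i j * v j))
      ≈⟨ sum-cong-≋ (λ j → sum-cong-≋ λ i → *-assoc (u i) (M i j) (v j)) ⟩
    sum (λ j → sum (λ i → u i * (M i j * v j)))  ≈⟨ ∑-comm (λ j i → u i * (M i j * v j)) ⟩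
    sum (λ i → sum (λ j → u i * (M i j * v j)))
      ≈⟨ sum-cong-≋ (λ i → sym (*-distribˡ-sum (u i) (λ j → M i j * v j))) ⟩
    sum (λ i → u i * (M i · v))                  ∎

  ᵥ*-cong : ∀ {m n} {u v : Vector Carrier m} (M : Vector (Vector Carrier n) m) → u ≋ v → u ᵥ* M ≋ v ᵥ* M
  ᵥ*-cong {u = u} {v} M u≋v j = ·-cong {u = u} {v} u≋v λ _ → refl

  ·-0ᵥ : ∀ {n} (u : Vector Carrier n) → u · 0ᵥ ≈ 0#
  ·-0ᵥ {zero}  u = refl
  ·-0ᵥ {suc n} u = trans (+-cong (zeroʳ (u 0F)) (·-0ᵥ (λ i → u (suc i)))) (+-identityˡ 0#)

  0ᵥ-· : ∀ {n} (u : Vector Carrier n) → 0ᵥ · u ≈ 0#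
  0ᵥ-· {zero}  u = refl
  0ᵥ-· {suc n} u = trans (+-cong (zeroˡ (u 0F)) (0ᵥ-· (λ i → u (suc i)))) (+-identityˡ 0#)

  1ᴹ-· : ∀ {n} i (u : Vector Carrier n) → 1ᴹ i · u ≈ u i
  1ᴹ-· 0F          u = trans (+-cong (*-identityˡ (u 0F)) (0ᵥ-· (λ i → u (suc i)))) (+-identityʳ (u 0F))
  1ᴹ-· (suc i) u = trans (+-cong (zeroˡ (u 0F)) (1ᴹ-· i (λ i → u (suc i)))) (+-identityˡ _)

  ᵥ*-1ᴹ : ∀ {n} (u : Vector Carrier n) → u ᵥ* 1ᴹ ≋ u
  ᵥ*-1ᴹ u 0F          = trans (+-cong (*-identityʳ (u 0F)) (·-0ᵥ (λ i → u (suc i)))) (+-identityʳ (u 0F))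
  ᵥ*-1ᴹ u (suc j) = trans (+-cong (zeroʳ (u 0F)) (ᵥ*-1ᴹ (λ i → u (suc i)) j)) (+-identityˡ _)

  ᵥ*-inverse : ∀ {n} {A B : Matrix n} → A *ᴹ B ≈ᴹ 1ᴹ → ∀ u → u ᵥ* A ᵥ* B ≋ u
  ᵥ*-inverse {A = A} {B} AB≈1 u j = begin
    (u ᵥ* A ᵥ* B) j          ≈⟨ ᵥ*-· u A (transpose B j) ⟩
    (u · λ i → (A *ᴹ B) i j)  ≈⟨ ·-cong {u = u} (λ _ → refl) (λ i → AB≈1 i j) ⟩
    (u ᵥ* 1ᴹ) j              ≈⟨ ᵥ*-1ᴹ u j ⟩
    u j                      ∎

  ⊗-cong : ∀ {u u′ v v′ : Vector Carrier 3} → u ≋ u′ → v ≋ v′ → u ⊗ v ≋ u′ ⊗ v′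
  ⊗-cong p r = λ
    { 0F → *-cong (p 0F) (r 0F)
    ; 1F → +-cong (*-cong (p 0F) (r 1F)) (*-cong (p 1F) (r 0F))
    ; 2F → +-cong (*-cong (p 0F) (r 2F)) (*-cong (p 2F) (r 0F))
    ; 3F → *-cong (p 1F) (r 1F)
    ; 4F → +-cong (*-cong (p 1F) (r 2F)) (*-cong (p 2F) (r 1F))
    ; 5F → *-cong (p 2F) (r 2F)
    }

  -- Row by row, what the monomials XᵢXⱼ become when X is replaced by AX: the second symmetric power
  -- of A.
  row-products : Matrix 3 → Vector (Vector Carrier 6) 6
  row-products A =
    A 0F ⊗ A 0F ∷ A 0F ⊗ A 1F ∷ A 0F ⊗ A 2F ∷
    A 1F ⊗ A 1F ∷ A 1F ⊗ A 2F ∷ A 2F ⊗ A 2F ∷ []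

  -- The form f(AX), X being a column vector of variables.
  substitute : Matrix 3 → Vector Carrier 6 → Vector Carrier 6
  substitute A f = f ᵥ* row-products A

  private
    -- `dot`, `tensor`, `powers` and `disc` repeat `_·_`, `_⊗_`, `squares` and `discriminant` in the
    -- syntax of the solver, with the same shape, so that `refl` closes the goals.
    dot : ∀ {k n} → Vector (Polynomial k) n → Vector (Polynomial k) n → Polynomial k
    dot u v = foldr _:+_ (con false) (zipWith _:*_ u v)

    tensor : ∀ {k} → Vector (Polynomial k) 3 → Vector (Polynomial k) 3 → Vector (Polynomial k) 6
    tensor u v =
      u 0F :* v 0F ∷
      u 0F :* v 1F :+ u 1F :* v 0F ∷
      u 0F :* v 2F :+ u 2F :* v 0F ∷
      u 1F :* v 1F ∷
      u 1F :* v 2F :+ u 2F :* v 1F ∷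
      u 2F :* v 2F ∷ []

    powers : ∀ {k} → Vector (Polynomial k) 3 → Vector (Polynomial k) 6
    powers w = w 0F :* w 0F ∷ w 0F :* w 1F ∷ w 0F :* w 2F ∷ w 1F :* w 1F ∷ w 1F :* w 2F ∷ w 2F :* w 2F ∷ []

    disc : ∀ {k} → Vector (Polynomial k) 6 → Polynomial k
    disc f = dot f (powers (f 4F ∷ f 2F ∷ f 1F ∷ []))

  -- The six monomials evaluated at w, so that `f · squares w` is the value f(w).
  squares : Vector Carrier 3 → Vector Carrier 6
  squares w = w 0F * w 0F ∷ w 0F * w 1F ∷ w 0F * w 2F ∷ w 1F * w 1F ∷ w 1F * w 2F ∷ w 2F * w 2F ∷ []

  ⊗-·-squares : ∀ u v w → (u ⊗ v) · squares w ≈ (u · w) * (v · w)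
  ⊗-·-squares u v w = solve 9
    (λ u₀ u₁ u₂ v₀ v₁ v₂ w₀ w₁ w₂ →
      let u = u₀ ∷ u₁ ∷ u₂ ∷ [] ; v = v₀ ∷ v₁ ∷ v₂ ∷ [] ; w = w₀ ∷ w₁ ∷ w₂ ∷ [] in
      dot (tensor u v) (powers w) := dot u w :* dot v w)
    refl (u 0F) (u 1F) (u 2F) (v 0F) (v 1F) (v 2F) (w 0F) (w 1F) (w 2F)

  -- The coefficient of Xⱼ² in f(AX) is the value of f at column j of A, and that of XⱼXₖ is the
  -- polar form of f at columns j and k. Both are computed for a product of linear forms.
  substitute-⊗ : ∀ A u v → substitute A (u ⊗ v) ≋ (u ᵥ* A) ⊗ (v ᵥ* A)
  substitute-⊗ A u v = λ
    { 0F → diagonal 0F ; 1F → mixed 0F 1F ; 2F → mixed 0F 2F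
    ; 3F → diagonal 1F ; 4F → mixed 1F 2F ; 5F → diagonal 2F }
    where
    diagonal : ∀ j → (u ⊗ v) · squares (transpose A j) ≈ (u · transpose A j) * (v · transpose A j)
    diagonal j = ⊗-·-squares u v (transpose A j)
    mixed : ∀ j k → let a = transpose A j ; b = transpose A k in
      (u ⊗ v) · (a 0F * b 0F + b 0F * a 0F ∷ a 0F * b 1F + b 0F * a 1F ∷ a 0F * b 2F + b 0F * a 2F ∷
                 a 1F * b 1F + b 1F * a 1F ∷ a 1F * b 2F + b 1F * a 2F ∷ a 2F * b 2F + b 2F * a 2F ∷ [])
      ≈ (u · a) * (v · b) + (u · b) * (v · a)
    mixed j k = solve 12
      (λ u₀ u₁ u₂ v₀ v₁ v₂ a₀ a₁ a₂ b₀ b₁ b₂ →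
        let u = u₀ ∷ u₁ ∷ u₂ ∷ [] ; v = v₀ ∷ v₁ ∷ v₂ ∷ []
            a = a₀ ∷ a₁ ∷ a₂ ∷ [] ; b = b₀ ∷ b₁ ∷ b₂ ∷ [] in
        dot (tensor u v)
          (a₀ :* b₀ :+ b₀ :* a₀ ∷ a₀ :* b₁ :+ b₀ :* a₁ ∷ a₀ :* b₂ :+ b₀ :* a₂ ∷
           a₁ :* b₁ :+ b₁ :* a₁ ∷ a₁ :* b₂ :+ b₁ :* a₂ ∷ a₂ :* b₂ :+ b₂ :* a₂ ∷ [])
        := dot u a :* dot v b :+ dot u b :* dot v a)
      refl (u 0F) (u 1F) (u 2F) (v 0F) (v 1F) (v 2F)
      (A 0F j) (A 1F j) (A 2F j) (A 0F k) (A 1F k) (A 2F k)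

  row-products-1ᴹ : ∀ f → f ᵥ* row-products 1ᴹ ≋ f
  row-products-1ᴹ f = λ
    { 0F → solve 6 (column 0F) refl (f 0F) (f 1F) (f 2F) (f 3F) (f 4F) (f 5F)
    ; 1F → solve 6 (column 1F) refl (f 0F) (f 1F) (f 2F) (f 3F) (f 4F) (f 5F)
    ; 2F → solve 6 (column 2F) refl (f 0F) (f 1F) (f 2F) (f 3F) (f 4F) (f 5F)
    ; 3F → solve 6 (column 3F) refl (f 0F) (f 1F) (f 2F) (f 3F) (f 4F) (f 5F)
    ; 4F → solve 6 (column 4F) refl (f 0F) (f 1F) (f 2F) (f 3F) (f 4F) (f 5F)
    ; 5F → solve 6 (column 5F) refl (f 0F) (f 1F) (f 2F) (f 3F) (f 4F) (f 5F)
    }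
    where
    column : Fin 6 → (f₀ f₁ f₂ f₃ f₄ f₅ : Polynomial 6) → Polynomial 6 × Polynomial 6
    column j f₀ f₁ f₂ f₃ f₄ f₅ =
      dot g (λ k → (tensor e₀ e₀ ∷ tensor e₀ e₁ ∷ tensor e₀ e₂ ∷ tensor e₁ e₁ ∷ tensor e₁ e₂ ∷ tensor e₂ e₂ ∷ []) k j) := g j
      where
      g : Vector (Polynomial 6) 6
      g = f₀ ∷ f₁ ∷ f₂ ∷ f₃ ∷ f₄ ∷ f₅ ∷ []
      e₀ e₁ e₂ : Vector (Polynomial 6) 3
      e₀ = con true ∷ con false ∷ con false ∷ []
      e₁ = con false ∷ con true ∷ con false ∷ []
      e₂ = con false ∷ con false ∷ con true ∷ []

  -- By `substitute-⊗`, substituting B into the product of two rows of A gives the product of the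
  -- same rows of AB, that is, of the identity.
  substitute-inverse : ∀ {A B} → A *ᴹ B ≈ᴹ 1ᴹ → ∀ f → substitute B (substitute A f) ≋ f
  substitute-inverse {A} {B} AB≈1 f j = begin
    substitute B (substitute A f) j               ≈⟨ ᵥ*-· f (row-products A) (λ k → row-products B k j) ⟩
    (f · λ i → substitute B (row-products A i) j)  ≈⟨ ·-cong {u = f} (λ _ → refl) (λ i → rows i j) ⟩
    (f · λ i → row-products 1ᴹ i j)                ≈⟨ row-products-1ᴹ f j ⟩
    f j                                            ∎
    where
    row : ∀ a b → substitute B (A a ⊗ A b) ≋ 1ᴹ a ⊗ 1ᴹ b
    row a b j = trans (substitute-⊗ B (A a) (A b) j) (⊗-cong (AB≈1 a) (AB≈1 b) j)
    rows : ∀ i → substitute B (row-products A i) ≋ row-products 1ᴹ i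
    rows = λ
      { 0F → row 0F 0F ; 1F → row 0F 1F ; 2F → row 0F 2F
      ; 3F → row 1F 1F ; 4F → row 1F 2F ; 5F → row 2F 2F }

  -- Both sides are Aᵢ M Aⱼᵀ, with M the symmetric matrix of z. This is the adjunction between
  -- substitution and M ↦ AMAᵀ, entry by entry.
  ⊗-· : ∀ A z i j → (A i ⊗ A j) · z ≈ (A *ᴹ symmetricMatrix z *ᴹ transpose A) i j
  ⊗-· A z i j = solve 12
    (λ u₀ u₁ u₂ v₀ v₁ v₂ z₀ z₁ z₂ z₃ z₄ z₅ →
      let u = u₀ ∷ u₁ ∷ u₂ ∷ [] ; v = v₀ ∷ v₁ ∷ v₂ ∷ [] in
      dot (tensor u v) (z₀ ∷ z₁ ∷ z₂ ∷ z₃ ∷ z₄ ∷ z₅ ∷ [])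
      := dot (dot u (z₀ ∷ z₁ ∷ z₂ ∷ []) ∷ dot u (z₁ ∷ z₃ ∷ z₄ ∷ []) ∷ dot u (z₂ ∷ z₄ ∷ z₅ ∷ []) ∷ []) v)
    refl (A i 0F) (A i 1F) (A i 2F) (A j 0F) (A j 1F) (A j 2F)
    (z 0F) (z 1F) (z 2F) (z 3F) (z 4F) (z 5F)

  -- In characteristic two the discriminant is the value of the form at the nucleus of its conic.
  nucleus : Vector Carrier 6 → Vector Carrier 3
  nucleus f = f 4F ∷ f 2F ∷ f 1F ∷ []

  discriminant : Vector Carrier 6 → Carrier
  discriminant f = f · squares (nucleus f)

  -- In characteristic two `nucleus (u ⊗ v)` is the cross product of u and v, so this is the triple
  -- product of the rows.
  determinant : Matrix 3 → Carrier
  determinant A = A 0F · nucleus (A 1F ⊗ A 2F)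

  -- For invertible A the map X ↦ AX carries the conic f(AX) = 0 to f = 0, and nucleus to nucleus;
  -- in coordinates the factor of proportionality is the determinant.
  nucleus-substitute : ∀ A f i → A i · nucleus (substitute A f) ≈ determinant A * nucleus f i
  nucleus-substitute A f = λ
    { 0F → solve 15 (row 0F) refl (f 0F) (f 1F) (f 2F) (f 3F) (f 4F) (f 5F)
        (A 0F 0F) (A 0F 1F) (A 0F 2F) (A 1F 0F) (A 1F 1F) (A 1F 2F) (A 2F 0F) (A 2F 1F) (A 2F 2F)
    ; 1F → solve 15 (row 1F) refl (f 0F) (f 1F) (f 2F) (f 3F) (f 4F) (f 5F)
        (A 0F 0F) (A 0F 1F) (A 0F 2F) (A 1F 0F) (A 1F 1F) (A 1F 2F) (A 2F 0F) (A 2F 1F) (A 2F 2F)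
    ; 2F → solve 15 (row 2F) refl (f 0F) (f 1F) (f 2F) (f 3F) (f 4F) (f 5F)
        (A 0F 0F) (A 0F 1F) (A 0F 2F) (A 1F 0F) (A 1F 1F) (A 1F 2F) (A 2F 0F) (A 2F 1F) (A 2F 2F)
    }
    where
    row : Fin 3 → (f₀ f₁ f₂ f₃ f₄ f₅ a b c d e g h k l : Polynomial 15) → Polynomial 15 × Polynomial 15
    row i f₀ f₁ f₂ f₃ f₄ f₅ a b c d e g h k l =
      dot (r i) (column 4F ∷ column 2F ∷ column 1F ∷ []) :=
      dot (r 0F) (tensor (r 1F) (r 2F) 4F ∷ tensor (r 1F) (r 2F) 2F ∷ tensor (r 1F) (r 2F) 1F ∷ []) :* (f₄ ∷ f₂ ∷ f₁ ∷ []) i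
      where
      r : Vector (Vector (Polynomial 15) 3) 3
      r = (a ∷ b ∷ c ∷ []) ∷ (d ∷ e ∷ g ∷ []) ∷ (h ∷ k ∷ l ∷ []) ∷ []
      column : Fin 6 → Polynomial 15
      column j = dot (f₀ ∷ f₁ ∷ f₂ ∷ f₃ ∷ f₄ ∷ f₅ ∷ []) λ k →
        (tensor (r 0F) (r 0F) ∷ tensor (r 0F) (r 1F) ∷ tensor (r 0F) (r 2F) ∷
         tensor (r 1F) (r 1F) ∷ tensor (r 1F) (r 2F) ∷ tensor (r 2F) (r 2F) ∷ []) k j

  squares-cong : ∀ {w w′} → w ≋ w′ → squares w ≋ squares w′
  squares-cong p = λ
    { 0F → *-cong (p 0F) (p 0F) ; 1F → *-cong (p 0F) (p 1F) ; 2F → *-cong (p 0F) (p 2F)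
    ; 3F → *-cong (p 1F) (p 1F) ; 4F → *-cong (p 1F) (p 2F) ; 5F → *-cong (p 2F) (p 2F) }

  discriminant-cong : ∀ {f g} → f ≋ g → discriminant f ≈ discriminant g
  discriminant-cong {f} {g} f≋g = ·-cong f≋g (squares-cong nucleus-cong)
    where
    nucleus-cong : nucleus f ≋ nucleus g
    nucleus-cong = λ { 0F → f≋g 4F ; 1F → f≋g 2F ; 2F → f≋g 1F }

  -- The value of f(AX) at its nucleus m is f(Am), and Am is the determinant times the nucleus of f.
  -- As f is quadratic, the determinant comes out squared.
  discriminant-substitute : ∀ A f →
    discriminant (substitute A f) ≈ determinant A * determinant A * discriminant f
  discriminant-substitute A f = begin
    substitute A f · squares m                ≈⟨ ᵥ*-· f (row-products A) (squares m) ⟩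
    (f · λ i → row-products A i · squares m)  ≈⟨ ·-cong {u = f} (λ _ → refl) products ⟩
    f · squares (λ i → A i · m)
      ≈⟨ ·-cong {u = f} (λ _ → refl) (squares-cong (nucleus-substitute A f)) ⟩
    f · squares (determinant A *ᵥ nucleus f)  ≈⟨ solve 7
      (λ δ f₀ f₁ f₂ f₃ f₄ f₅ →
        let f = f₀ ∷ f₁ ∷ f₂ ∷ f₃ ∷ f₄ ∷ f₅ ∷ [] in
        dot f (powers (δ :* f₄ ∷ δ :* f₂ ∷ δ :* f₁ ∷ [])) := δ :* δ :* disc f)
      refl (determinant A) (f 0F) (f 1F) (f 2F) (f 3F) (f 4F) (f 5F) ⟩
    determinant A * determinant A * discriminant f ∎
    where
    m : Vector Carrier 3
    m = nucleus (substitute A f)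
    products : ∀ i → row-products A i · squares m ≈ squares (λ i → A i · m) i
    products = λ
      { 0F → ⊗-·-squares (A 0F) (A 0F) m ; 1F → ⊗-·-squares (A 0F) (A 1F) m ; 2F → ⊗-·-squares (A 0F) (A 2F) m
      ; 3F → ⊗-·-squares (A 1F) (A 1F) m ; 4F → ⊗-·-squares (A 1F) (A 2F) m ; 5F → ⊗-·-squares (A 2F) (A 2F) m }

  discriminant-*ᵥ : ∀ x f → discriminant (x *ᵥ f) ≈ x * x * x * discriminant f
  discriminant-*ᵥ x f = solve 7
    (λ x f₀ f₁ f₂ f₃ f₄ f₅ →
      disc (x :* f₀ ∷ x :* f₁ ∷ x :* f₂ ∷ x :* f₃ ∷ x :* f₄ ∷ x :* f₅ ∷ [])
      := x :* x :* x :* disc (f₀ ∷ f₁ ∷ f₂ ∷ f₃ ∷ f₄ ∷ f₅ ∷ []))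
    refl x (f 0F) (f 1F) (f 2F) (f 3F) (f 4F) (f 5F)

  -- The nucleus of a product of linear forms is their cross product, a common zero of both factors.
  discriminant-⊗ : ∀ u v → discriminant (u ⊗ v) ≈ 0#
  discriminant-⊗ u v = solve 6
    (λ u₀ u₁ u₂ v₀ v₁ v₂ → disc (tensor (u₀ ∷ u₁ ∷ u₂ ∷ []) (v₀ ∷ v₁ ∷ v₂ ∷ [])) := con false)
    refl (u 0F) (u 1F) (u 2F) (v 0F) (v 1F) (v 2F)

  -- Modulo two the term with 4 vanishes, signs do not matter, and the three copies of f₁f₂f₄ in the
  -- value at the nucleus reduce to one.
  discriminant-formula : ∀ f →
    4 ×ₙ (f 0F * f 3F * f 5F) + f 1F * f 2F * f 4F
      - f 0F * (f 4F * f 4F) - f 3F * (f 2F * f 2F) - f 5F * (f 1F * f 1F)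
    ≈ discriminant f
  discriminant-formula f = solve 6
    (λ f₀ f₁ f₂ f₃ f₄ f₅ →
      let t = f₀ :* f₃ :* f₅ in
      (t :+ (t :+ (t :+ (t :+ con false)))) :+ f₁ :* f₂ :* f₄
        :- f₀ :* (f₄ :* f₄) :- f₃ :* (f₂ :* f₂) :- f₅ :* (f₁ :* f₁)
      := disc (f₀ ∷ f₁ ∷ f₂ ∷ f₃ ∷ f₄ ∷ f₅ ∷ []))
    refl (f 0F) (f 1F) (f 2F) (f 3F) (f 4F) (f 5F)

  -- `Carrier ⊎ ⊤` is a projective line: the forms X² + dZ² and, at infinity, Z².
  form₁ : Carrier ⊎ ⊤ → Vector Carrier 6
  form₁ (inj₁ d)  = 1# ∷ 0# ∷ 0# ∷ 0# ∷ 0# ∷ d ∷ []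
  form₁ (inj₂ tt) = 0# ∷ 0# ∷ 0# ∷ 0# ∷ 0# ∷ 1# ∷ []

  form₂ : Carrier × Carrier → Vector Carrier 6
  form₂ (a , d) = a ∷ 0# ∷ 1# ∷ 0# ∷ 0# ∷ d ∷ []

  -- The first coefficient is chosen so that e is the discriminant.
  form₃ : Carrier × Carrier × Carrier → Vector Carrier 6
  form₃ (b , d , e) = b * b + b + d + e ∷ 1# ∷ b ∷ 1# ∷ 1# ∷ d ∷ []

  -- Up to scalars, the nonzero forms with a₀₁ = a₁₁ = a₁₂.
  Parameter : Set c
  Parameter = (Carrier ⊎ ⊤) ⊎ (Carrier × Carrier) ⊎ (Carrier × Carrier × Carrier)

  form : Parameter → Vector Carrier 6
  form (inj₁ p)        = form₁ p
  form (inj₂ (inj₁ p)) = form₂ p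
  form (inj₂ (inj₂ p)) = form₃ p

  form-net : ∀ p → form p 1F ≈ form p 3F × form p 3F ≈ form p 4F
  form-net (inj₁ (inj₁ d))  = refl , refl
  form-net (inj₁ (inj₂ tt)) = refl , refl
  form-net (inj₂ (inj₁ p))  = refl , refl
  form-net (inj₂ (inj₂ p))  = refl , refl

  discriminant-form₁ : ∀ p → discriminant (form₁ p) ≈ 0#
  discriminant-form₁ (inj₁ d) = solve 1
    (λ d → let o = con false in disc (con true ∷ o ∷ o ∷ o ∷ o ∷ d ∷ []) := o) refl d
  discriminant-form₁ (inj₂ tt) = solve 0
    (let o = con false in disc (o ∷ o ∷ o ∷ o ∷ o ∷ con true ∷ []) := o) refl

  discriminant-form₂ : ∀ p → discriminant (form₂ p) ≈ 0#
  discriminant-form₂ (a , d) = solve 2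
    (λ a d → let o = con false in disc (a ∷ o ∷ con true ∷ o ∷ o ∷ d ∷ []) := o) refl a d

  discriminant-form₃ : ∀ b d e → discriminant (form₃ (b , d , e)) ≈ e
  discriminant-form₃ = solve 3
    (λ b d e → let i = con true in disc (b :* b :+ b :+ d :+ e ∷ i ∷ b ∷ i ∷ i ∷ d ∷ []) := e) refl

  -- Since s(s + 1) = ad, a times the form is (aX + sZ)(aX + (s + 1)Z). The identity is used over
  -- `F` for real pairs and over `E` for imaginary ones.
  form₂-factors : ∀ {a a⁻¹ d s} → a⁻¹ * a ≈ 1# → s * s + s ≈ a * d →
    form₂ (a , d) ≋ a⁻¹ *ᵥ ((a ∷ 0# ∷ s ∷ []) ⊗ (a ∷ 0# ∷ s + 1# ∷ []))
  form₂-factors {a} {a⁻¹} {d} {s} a⁻¹a≈1 s²+s≈ad = λ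
    { 0F → sym (trans (sym (*-assoc a⁻¹ a a)) (trans (*-congʳ a⁻¹a≈1) (*-identityˡ a)))
    ; 1F → solve 2 (λ a a⁻¹ → o := a⁻¹ :* (a :* o :+ o :* a)) refl a a⁻¹
    ; 2F → trans (sym a⁻¹a≈1) (solve 3 (λ a a⁻¹ s → a⁻¹ :* a := a⁻¹ :* (a :* (s :+ con true) :+ s :* a)) refl a a⁻¹ s)
    ; 3F → solve 1 (λ a⁻¹ → o := a⁻¹ :* (o :* o)) refl a⁻¹
    ; 4F → solve 2 (λ a⁻¹ s → o := a⁻¹ :* (o :* (s :+ con true) :+ s :* o)) refl a⁻¹ s
    ; 5F → begin
        d                     ≈⟨ *-identityˡ d ⟨
        1# * d                ≈⟨ *-congʳ a⁻¹a≈1 ⟨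
        a⁻¹ * a * d           ≈⟨ *-assoc a⁻¹ a d ⟩
        a⁻¹ * (a * d)         ≈⟨ *-congˡ s²+s≈ad ⟨
        a⁻¹ * (s * s + s)
          ≈⟨ solve 2 (λ a⁻¹ s → a⁻¹ :* (s :* s :+ s) := a⁻¹ :* (s :* (s :+ con true))) refl a⁻¹ s ⟩
        a⁻¹ * (s * (s + 1#))  ∎
    }
    where
    o : ∀ {n} → Polynomial n
    o = con false

  -- With U = X + Z and V = Y + bX the factors are V + sU and V + (s + 1)U, written out in X, Y, Z.
  form₃-factors : ∀ {b d e s} → e ≈ 0# → s * s + s ≈ d →
    form₃ (b , d , e) ≋ (b + s ∷ 1# ∷ s ∷ []) ⊗ (b + s + 1# ∷ 1# ∷ s + 1# ∷ [])
  form₃-factors {b} {d} {e} {s} e≈0 s²+s≈d = λ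
    { 0F → begin
        b * b + b + d + e               ≈⟨ +-cong (+-congˡ (sym s²+s≈d)) e≈0 ⟩
        b * b + b + (s * s + s) + 0#
          ≈⟨ solve 2 (λ b s → b :* b :+ b :+ (s :* s :+ s) :+ con false := (b :+ s) :* (b :+ s :+ con true)) refl b s ⟩
        (b + s) * (b + s + 1#)          ∎
    ; 1F → solve 2 (λ b s → con true := (b :+ s) :* con true :+ con true :* (b :+ s :+ con true)) refl b s
    ; 2F → solve 2 (λ b s → b := (b :+ s) :* (s :+ con true) :+ s :* (b :+ s :+ con true)) refl b s
    ; 3F → sym (*-identityˡ 1#)
    ; 4F → solve 1 (λ s → con true := con true :* (s :+ con true) :+ s :* con true) refl s
    ; 5F → trans (sym s²+s≈d) (solve 1 (λ s → s :* s :+ s := s :* (s :+ con true)) refl s)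
    }

  -- The case a = 0, out of reach of `form₂-factors`, which divides by a: the form is Z(X + dZ).
  form₂-factors₀ : ∀ {a d} → a ≈ 0# → form₂ (a , d) ≋ (0# ∷ 0# ∷ 1# ∷ []) ⊗ (1# ∷ 0# ∷ d ∷ [])
  form₂-factors₀ {a} {d} a≈0 = λ
    { 0F → trans a≈0 (solve 0 (o := o :* i) refl)
    ; 1F → solve 0 (o := o :* o :+ o :* i) refl
    ; 2F → solve 1 (λ d → i := o :* d :+ i :* i) refl d
    ; 3F → solve 0 (o := o :* o) refl
    ; 4F → solve 1 (λ d → o := o :* d :+ i :* o) refl d
    ; 5F → sym (*-identityˡ d)
    }
    where
    o i : ∀ {n} → Polynomial n
    o = con false
    i = con true

  scaled-⊗ : ∀ x u v → x *ᵥ (u ⊗ v) ≋ (x *ᵥ u) ⊗ v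
  scaled-⊗ x u v = λ
    { 0F → diagonal 0F ; 1F → mixed 0F 1F ; 2F → mixed 0F 2F
    ; 3F → diagonal 1F ; 4F → mixed 1F 2F ; 5F → diagonal 2F }
    where
    diagonal : ∀ i → x * (u i * v i) ≈ x * u i * v i
    diagonal i = sym (*-assoc x (u i) (v i))
    mixed : ∀ i j → x * (u i * v j + u j * v i) ≈ x * u i * v j + x * u j * v i
    mixed i j = solve 5 (λ x a b c d → x :* (a :* d :+ b :* c) := x :* a :* d :+ x :* b :* c)
      refl x (u i) (u j) (v i) (v j)

  -- The matrices [0 x 0; x x+y y; 0 y 0] of the representative line.
  net-point : Vector Carrier 2 → Vector Carrier 6
  net-point w = 0# ∷ w 0F ∷ 0# ∷ w 0F + w 1F ∷ w 1F ∷ 0# ∷ []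

  ·-net-point : ∀ f w → f · net-point w ≈ (f 1F + f 3F) * w 0F + (f 3F + f 4F) * w 1F
  ·-net-point f w = solve 8
    (λ f₀ f₁ f₂ f₃ f₄ f₅ x y →
      dot (f₀ ∷ f₁ ∷ f₂ ∷ f₃ ∷ f₄ ∷ f₅ ∷ []) (con false ∷ x ∷ con false ∷ x :+ y ∷ y ∷ con false ∷ [])
      := (f₁ :+ f₃) :* x :+ (f₃ :+ f₄) :* y)
    refl (f 0F) (f 1F) (f 2F) (f 3F) (f 4F) (f 5F) (w 0F) (w 1F)

  -- Common core of the invariance of `H₁`, `H₂ᵣ` and `H₂ᵢ`; in the last case it is applied over
  -- `E`.
  substitute-scaled-⊗ : ∀ {A x y f g u v} → g ≋ x *ᵥ substitute A f → f ≋ y *ᵥ (u ⊗ v) →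
    g ≋ (x * y) *ᵥ ((u ᵥ* A) ⊗ (v ᵥ* A))
  substitute-scaled-⊗ {A} {x} {y} {f} {g} {u} {v} g≋xfA f≋yuv j = begin
    g j                                    ≈⟨ g≋xfA j ⟩
    x * substitute A f j                   ≈⟨ *-congˡ (ᵥ*-cong {u = f} (row-products A) f≋yuv j) ⟩
    x * substitute A (y *ᵥ (u ⊗ v)) j      ≈⟨ *-congˡ (*ᵥ-· y (u ⊗ v) (λ i → row-products A i j)) ⟩
    x * (y * substitute A (u ⊗ v) j)       ≈⟨ *-congˡ (*-congˡ (substitute-⊗ A u v j)) ⟩
    x * (y * ((u ᵥ* A) ⊗ (v ᵥ* A)) j)      ≈⟨ *-assoc x y _ ⟨
    x * y * ((u ᵥ* A) ⊗ (v ᵥ* A)) j        ∎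

-- Finite fields

module FieldProperties {c ℓ : Level} (F : Field c ℓ) where
  open Field F hiding (zero)
  open Relation.Binary.Reasoning.Setoid setoid

  inverse : ∀ {x} → ¬ x ≈ 0# → ∃ λ y → y * x ≈ 1#
  inverse x≉0 with y , yx≈1 , _ ← invertible _ x≉0 = y , yx≈1

  inverse≉0 : ∀ {x y} → y * x ≈ 1# → ¬ y ≈ 0#
  inverse≉0 {x} yx≈1 y≈0 = 1≉0 (trans (sym yx≈1) (trans (*-congʳ y≈0) (zeroˡ x)))

  *-cancelˡ : ∀ {x y z} → ¬ x ≈ 0# → x * y ≈ x * z → y ≈ z
  *-cancelˡ {x} {y} {z} x≉0 xy≈xz with x⁻¹ , x⁻¹x≈1 ← inverse x≉0 = begin
    y              ≈⟨ cancel y ⟨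
    x⁻¹ * (x * y)  ≈⟨ *-congˡ xy≈xz ⟩
    x⁻¹ * (x * z)  ≈⟨ cancel z ⟩
    z              ∎
    where
    cancel : ∀ y → x⁻¹ * (x * y) ≈ y
    cancel y = trans (sym (*-assoc x⁻¹ x y)) (trans (*-congʳ x⁻¹x≈1) (*-identityˡ y))

  *-cancelʳ : ∀ {x y z} → ¬ x ≈ 0# → y * x ≈ z * x → y ≈ z
  *-cancelʳ {x} {y} {z} x≉0 yx≈zx = *-cancelˡ x≉0 (trans (*-comm x y) (trans yx≈zx (*-comm z x)))

  integral : ∀ {x y} → ¬ x ≈ 0# → x * y ≈ 0# → y ≈ 0#
  integral {x} x≉0 xy≈0 = *-cancelˡ x≉0 (trans xy≈0 (sym (zeroʳ x)))

  *≉0 : ∀ {x y} → ¬ x ≈ 0# → ¬ y ≈ 0# → ¬ x * y ≈ 0#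
  *≉0 x≉0 y≉0 = y≉0 ∘ integral x≉0

module FiniteField {c ℓ : Level} (F : Field c ℓ) {n : ℕ} (|F| : Field.setoid F HasCardinality n) where
  open Field F hiding (zero)
  open FieldProperties F public
  open Finite |F| public
  open Relation.Binary.Reasoning.Setoid setoid
  open Algebra.Properties.CommutativeSemiring.Exp commutativeSemiring public
    using (_^_; ^-congˡ; ^-assocʳ; ^-homo-*; ^-distrib-*)
  open Algebra.Properties.Semiring.Mult semiring using (×1-homo-*) renaming (_×_ to _×ₙ_)

  Nonzero# : Pred Carrier ℓ
  Nonzero# x = ¬ x ≈ 0#

  |0#| : Subsetoid setoid (_≈ 0#) HasCardinality 1
  |0#| = cardinality-↔ (bijection⇒inverse (λ _ → 0# , refl) (λ _ → refl) (λ _ → ≡.refl) λ (_ , x≈0) → tt , sym x≈0)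
    cardinality-⊤

  |Nonzero#| : Subsetoid setoid Nonzero# HasCardinality (n ℕ.∸ 1)
  |Nonzero#| = complement-cardinality (λ x≈y x≈0 → trans (sym x≈y) x≈0) (_≟ 0#) |0#|

  -- Multiplication by x permutes the nonzero elements, hence fixes their product.
  ^-unit : ∀ {x} → Nonzero# x → x ^ (n ℕ.∸ 1) ≈ 1#
  ^-unit {x} x≉0 = *-cancelʳ (product≉0 units) (begin
    x ^ (n ℕ.∸ 1) * sum unit                        ≈⟨ *-congʳ (sum-replicate (n ℕ.∸ 1)) ⟨
    sum (replicate (n ℕ.∸ 1) x) * sum unit  ≈⟨ ∑-distrib-+ (replicate (n ℕ.∸ 1) x) unit ⟨
    sum (λ i → x * unit i)                          ≈⟨ sum-cong-≋ (λ i → proj₂-index (mul (units i))) ⟨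
    sum (λ i → unit (Inverse.to π i))               ≈⟨ sum-permute unit π ⟨
    sum unit                                        ≈⟨ *-identityˡ (sum unit) ⟨
    1# * sum unit                                   ∎)
    where
    -- In the multiplicative monoid `sum` denotes the product, and `sum-replicate` yields a power.
    open Algebra.Properties.CommutativeMonoid.Sum *-commutativeMonoid
    U = Subsetoid setoid Nonzero#
    open Inverse |Nonzero#| using () renaming (to to units; strictlyInverseˡ to proj₂-index)
    unit : Fin (n ℕ.∸ 1) → Carrier
    unit = proj₁ ∘ units
    product≉0 : ∀ {m} (v : Fin m → ∃ Nonzero#) → Nonzero# (sum (proj₁ ∘ v))
    product≉0 {zero}  v = 1≉0
    product≉0 {suc m} v = *≉0 (proj₂ (v zero)) (product≉0 (v ∘ suc))
    mul : ∃ Nonzero# → ∃ Nonzero#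
    mul (y , y≉0) = x * y , *≉0 x≉0 y≉0
    mul-↔ : Inverse U U
    mul-↔ = bijection⇒inverse mul *-congˡ (*-cancelˡ x≉0) λ (y , y≉0) →
      let x⁻¹ , x⁻¹x≈1 = inverse x≉0 in
      (x⁻¹ * y , *≉0 (inverse≉0 x⁻¹x≈1) y≉0) ,
      trans (sym (*-assoc x x⁻¹ y)) (trans (*-congʳ (trans (*-comm x x⁻¹) x⁻¹x≈1)) (*-identityˡ y))
    π : Permutation (n ℕ.∸ 1) (n ℕ.∸ 1)
    π = Inverseₚ.trans |Nonzero#| (Inverseₚ.trans mul-↔ (Inverseₚ.sym |Nonzero#|))

  1≤order : 1 ≤ n
  1≤order = ℕ.≤-trans (s≤s z≤n) (Fin.toℕ<n (index 0#))

  fermat : ∀ x → x ^ n ≈ x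
  fermat x = trans (reflexive (≡.cong (x ^_) (≡.sym (ℕ.m+[n∸m]≡n 1≤order)))) (x^1+[n∸1]≈x (x ≟ 0#))
    where
    x^1+[n∸1]≈x : Dec (x ≈ 0#) → x * x ^ (n ℕ.∸ 1) ≈ x
    x^1+[n∸1]≈x (yes x≈0) = trans (*-congʳ x≈0) (trans (zeroˡ _) (sym x≈0))
    x^1+[n∸1]≈x (no  x≉0) = trans (*-congˡ (^-unit x≉0)) (*-identityʳ x)

  -- Translation by 1 permutes the elements, hence fixes their sum.
  order×1≈0 : n ×ₙ 1# ≈ 0#
  order×1≈0 = identityʳ-unique (sum element) (n ×ₙ 1#) (begin
    sum element + n ×ₙ 1#                   ≈⟨ +-congˡ (sum-replicate n) ⟨
    sum element + sum (replicate n 1#)  ≈⟨ ∑-distrib-+ element (replicate n 1#) ⟨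
    sum (λ i → element i + 1#)              ≈⟨ sum-cong-≋ (λ i → element-index (element i + 1#)) ⟨
    sum (λ i → element (Inverse.to π i))    ≈⟨ sum-permute element π ⟨
    sum element                             ∎)
    where
    open Algebra.Properties.CommutativeMonoid.Sum +-commutativeMonoid
    open Algebra.Properties.Group +-group using (identityʳ-unique; ∙-cancelʳ)
    shift : Inverse setoid setoid
    shift = bijection⇒inverse (_+ 1#) +-congʳ (∙-cancelʳ 1# _ _) λ y → y + - 1# ,
      trans (+-assoc y (- 1#) 1#) (trans (+-congˡ (-‿inverseˡ 1#)) (+-identityʳ y))
    π : Permutation n n
    π = Inverseₚ.trans |F| (Inverseₚ.trans shift (Inverseₚ.sym |F|))

  -- The order annihilates 1, and n ↦ n · 1 is multiplicative. In a field a power of two can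
  -- annihilate 1 only if 2 does.
  order≡2^k⇒1+1≈0 : ∀ k → n ≡ 2 ℕ.^ k → HasCharacteristicTwo commutativeRing
  order≡2^k⇒1+1≈0 k n≡2^k = decidable-stable (1# + 1# ≟ 0#) λ 1+1≉0 →
    2^k×1≉0 1+1≉0 k (trans (reflexive (≡.cong (_×ₙ 1#) (≡.sym n≡2^k))) order×1≈0)
    where
    2^k×1≉0 : ¬ 1# + 1# ≈ 0# → ∀ k → ¬ (2 ℕ.^ k) ×ₙ 1# ≈ 0#
    2^k×1≉0 1+1≉0 zero    1×1≈0 = 1≉0 (trans (sym (+-identityʳ 1#)) 1×1≈0)
    2^k×1≉0 1+1≉0 (suc k) 2^k×1≈0 = 2^k×1≉0 1+1≉0 k
      (integral 2×1≉0 (trans (sym (×1-homo-* 2 (2 ℕ.^ k))) 2^k×1≈0))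
      where
      2×1≉0 : ¬ 2 ×ₙ 1# ≈ 0#
      2×1≉0 2×1≈0 = 1+1≉0 (trans (+-congˡ (sym (+-identityʳ 1#))) 2×1≈0)

-- Fields of characteristic two

module CharacteristicTwoField {c ℓ : Level} (F : Field c ℓ)
  (1+1≈0 : HasCharacteristicTwo (Field.commutativeRing F)) where
  open Field F hiding (zero)
  open FieldProperties F
  open CharacteristicTwo commutativeRing 1+1≈0
  open Algebra.Properties.CommutativeSemiring.Exp commutativeSemiring
    using (_^_; ^-congˡ; ^-assocʳ)
  open Relation.Binary.Reasoning.Setoid setoid

  -- The monic polynomial whose lower coefficients are listed from the constant one upwards.
  monic : ∀ {n} → Vec Carrier n → Carrier → Carrier
  monic Vec.[]       x = 1#
  monic (a Vec.∷ as) x = a + x * monic as x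

  -- Synthetic division by x + r: the coefficients are Horner's partial values at r.
  quotient : ∀ {n} → Vec Carrier (suc n) → Carrier → Vec Carrier n
  quotient {zero}  (a Vec.∷ Vec.[]) r = Vec.[]
  quotient {suc n} (a Vec.∷ as) r = monic as r Vec.∷ quotient as r

  monic-quotient : ∀ {n} (as : Vec Carrier (suc n)) r x →
    monic as x + monic as r ≈ (x + r) * monic (quotient as r) x
  monic-quotient {zero} (a Vec.∷ Vec.[]) r x = solve 3
    (λ a r x → (a :+ x :* con true) :+ (a :+ r :* con true) := (x :+ r) :* con true) refl a r x
  monic-quotient {suc n} (a Vec.∷ as) r x = begin
    (a + x * g) + (a + r * h)      ≈⟨ solve 5 (λ a r x g h →
      (a :+ x :* g) :+ (a :+ r :* h) := x :* (g :+ h) :+ (x :+ r) :* h) refl a r x g h ⟩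
    x * (g + h) + (x + r) * h      ≈⟨ +-congʳ (*-congˡ (monic-quotient as r x)) ⟩
    x * ((x + r) * k) + (x + r) * h  ≈⟨ solve 4 (λ r x h k →
      x :* ((x :+ r) :* k) :+ (x :+ r) :* h := (x :+ r) :* (h :+ x :* k)) refl r x h k ⟩
    (x + r) * (h + x * k)          ∎
    where
    g h k : Carrier
    g = monic as x
    h = monic as r
    k = monic (quotient as r) x

  -- After division by x + z₀ the other roots are roots of the quotient, since x + z₀ does not
  -- vanish at them; in degree 0 the polynomial is 1.
  monic-roots : ∀ {n} (as : Vec Carrier n) (z : Fin (suc n) → Carrier) →
    Injective _≡_ _≈_ z → ¬ (∀ i → monic as (z i) ≈ 0#)
  monic-roots Vec.[]       z injective roots = 1≉0 (roots zero)
  monic-roots {suc n} as z injective roots = monic-roots (quotient as (z zero)) (z ∘ suc)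
    (Fin.suc-injective ∘ injective)
    λ i → integral (λ z+z≈0 → contradiction (injective (x+y≈0⇒x≈y z+z≈0)) λ ())
      (trans (sym (monic-quotient as (z zero) (z (suc i))))
        (trans (+-cong (roots (suc i)) (roots zero)) (+-identityˡ 0#)))

  -- The fixed points are roots of xⁿ + x, which is monic of degree n because n ≥ 2 keeps x below
  -- the leading term.
  ^-fixed-points : ∀ {n} → 2 ≤ n → (z : Fin (suc n) → Carrier) → Injective _≡_ _≈_ z →
    ¬ (∀ i → z i ^ n ≈ z i)
  ^-fixed-points {suc (suc n)} (s≤s (s≤s z≤n)) z injective fixed =
    monic-roots (0# Vec.∷ 1# Vec.∷ Vec.replicate n 0#) z injective λ i → begin
      0# + z i * (1# + z i * monic (Vec.replicate n 0#) (z i))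
        ≈⟨ +-congˡ (*-congˡ (+-congˡ (*-congˡ (monic-0 n (z i))))) ⟩
      0# + z i * (1# + z i * z i ^ n)  ≈⟨ solve 2 (λ x y →
        con false :+ x :* (con true :+ x :* y) := x :* (x :* y) :+ x) refl (z i) (z i ^ n) ⟩
      z i ^ suc (suc n) + z i          ≈⟨ +-congʳ (fixed i) ⟩
      z i + z i                        ≈⟨ x+x≈0 (z i) ⟩
      0#                               ∎
    where
    monic-0 : ∀ n x → monic (Vec.replicate n 0#) x ≈ x ^ n
    monic-0 zero    x = refl
    monic-0 (suc n) x = trans (+-identityˡ _) (*-congˡ (monic-0 n x))

  frobenius : ∀ m x y → (x + y) ^ (2 ℕ.^ m) ≈ x ^ (2 ℕ.^ m) + y ^ (2 ℕ.^ m)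
  frobenius zero    x y = solve 2 (λ x y → (x :+ y) :* con true := x :* con true :+ y :* con true) refl x y
  frobenius (suc m) x y = begin
    (x + y) ^ (2 ℕ.* 2 ℕ.^ m)                     ≈⟨ ^-assocʳ (x + y) 2 (2 ℕ.^ m) ⟨
    ((x + y) ^ 2) ^ (2 ℕ.^ m)                     ≈⟨ ^-congˡ (2 ℕ.^ m) (solve 2 (λ x y →
      (x :+ y) :* ((x :+ y) :* con true) := x :* (x :* con true) :+ y :* (y :* con true)) refl x y) ⟩
    (x ^ 2 + y ^ 2) ^ (2 ℕ.^ m)                   ≈⟨ frobenius m (x ^ 2) (y ^ 2) ⟩
    (x ^ 2) ^ (2 ℕ.^ m) + (y ^ 2) ^ (2 ℕ.^ m)     ≈⟨ +-cong (^-assocʳ x 2 (2 ℕ.^ m)) (^-assocʳ y 2 (2 ℕ.^ m)) ⟩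
    x ^ (2 ℕ.* 2 ℕ.^ m) + y ^ (2 ℕ.* 2 ℕ.^ m)     ∎

  ℘ : Carrier → Carrier
  ℘ t = t * t + t

  ℘-cong : ∀ {s t} → s ≈ t → ℘ s ≈ ℘ t
  ℘-cong s≈t = +-cong (*-cong s≈t s≈t) s≈t

  ℘-+ : ∀ s t → ℘ (s + t) ≈ ℘ s + ℘ t
  ℘-+ = solve 2 (λ s t → (s :+ t) :* (s :+ t) :+ (s :+ t) := (s :* s :+ s) :+ (t :* t :+ t)) refl

  ℘-+1 : ∀ t → ℘ (t + 1#) ≈ ℘ t
  ℘-+1 = solve 1 (λ t → (t :+ con true) :* (t :+ con true) :+ (t :+ con true) := t :* t :+ t) refl

  ∈℘ : Pred Carrier (c ⊔ ℓ)
  ∈℘ y = ∃ λ t → ℘ t ≈ y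

  ∈℘-resp : ∈℘ Respects _≈_
  ∈℘-resp y≈z (t , ℘t≈y) = t , trans ℘t≈y y≈z

  -- `℘ s + ℘ t` factors as (s + t)(s + t + 1).
  ℘-fibre : ∀ {s t} → ℘ s ≈ ℘ t → ¬ s ≈ t → s ≈ t + 1#
  ℘-fibre {s} {t} ℘s≈℘t s≉t = x+y≈0⇒x≈y (integral {s + t} (s≉t ∘ x+y≈0⇒x≈y) (begin
    (s + t) * (s + (t + 1#))  ≈⟨ solve 2 (λ s t →
      (s :+ t) :* (s :+ (t :+ con true)) := (s :* s :+ s) :+ (t :* t :+ t)) refl s t ⟩
    ℘ s + ℘ t                 ≈⟨ +-congʳ ℘s≈℘t ⟩
    ℘ t + ℘ t                 ≈⟨ x+x≈0 (℘ t) ⟩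
    0#                        ∎))

  -- s and s̄ are the roots of T² + T + s s̄. They are the two summands of a mixed coefficient over
  -- `F`, or two conjugates in `E`.
  ℘≈norm : ∀ {s s̄} → s + s̄ ≈ 1# → ℘ s ≈ s * s̄
  ℘≈norm {s} {s̄} trace = begin
    s * s + s            ≈⟨ +-congˡ (*-identityʳ s) ⟨
    s * s + s * 1#       ≈⟨ +-congˡ (*-congˡ trace) ⟨
    s * s + s * (s + s̄)  ≈⟨ solve 2 (λ s s̄ → s :* s :+ s :* (s :+ s̄) := s :* s̄) refl s s̄ ⟩
    s * s̄                ∎

  open LinearAlgebra commutativeRing
  open Projective F

  -- In characteristic two these are the 2 by 2 minors of the rows u and v, and for n = 3 also the
  -- mixed coefficients of `u ⊗ v`. Whether two factors are proportional can thus be read off their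
  -- product.
  polar : ∀ {n} → Vector Carrier n → Vector Carrier n → Fin n → Fin n → Carrier
  polar u v i j = u i * v j + u j * v i

  module _ {n} {u v : Vector Carrier n} {i j} (polar≉0 : ¬ polar u v i j ≈ 0#) where

    polar≉0⇒Nonzeroˡ : Nonzero u
    polar≉0⇒Nonzeroˡ u≋0 = polar≉0 (begin
      u i * v j + u j * v i  ≈⟨ +-cong (*-congʳ (u≋0 i)) (*-congʳ (u≋0 j)) ⟩
      0# * v j + 0# * v i    ≈⟨ +-cong (zeroˡ (v j)) (zeroˡ (v i)) ⟩
      0# + 0#                ≈⟨ +-identityˡ 0# ⟩
      0#                     ∎)

    polar≉0⇒Nonzeroʳ : Nonzero v
    polar≉0⇒Nonzeroʳ v≋0 = polar≉0 (begin
      u i * v j + u j * v i  ≈⟨ +-cong (*-congˡ (v≋0 j)) (*-congˡ (v≋0 i)) ⟩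
      u i * 0# + u j * 0#    ≈⟨ +-cong (zeroʳ (u i)) (zeroʳ (u j)) ⟩
      0# + 0#                ≈⟨ +-identityˡ 0# ⟩
      0#                     ∎)

    polar≉0⇒≁ : ¬ u ∼ v
    polar≉0⇒≁ (x , _ , u≋xv) = polar≉0 (begin
      u i * v j + u j * v i              ≈⟨ +-cong (*-congʳ (u≋xv i)) (*-congʳ (u≋xv j)) ⟩
      x * v i * v j + x * v j * v i
        ≈⟨ solve 3 (λ x a b → x :* a :* b :+ x :* b :* a := con false) refl x (v i) (v j) ⟩
      0#                                 ∎)

  -- The ratio is read off at a coordinate where v does not vanish; it is nonzero because u is.
  polar≈0⇒∼ : Decidable₂ _≈_ → ∀ {n} {u v : Vector Carrier n} → Nonzero u → Nonzero v →
    (∀ i j → polar u v i j ≈ 0#) → u ∼ v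
  polar≈0⇒∼ _≟_ {n} {u} {v} u≢0 v≢0 polar≈0
    with i , vᵢ≉0 ← Fin.¬∀⟶∃¬ n (λ i → v i ≈ 0#) (λ i → v i ≟ 0#) v≢0
    with vᵢ⁻¹ , vᵢ⁻¹vᵢ≈1 ← inverse vᵢ≉0
    = u i * vᵢ⁻¹ , (λ x≈0 → u≢0 λ j → trans (u≋xv j) (trans (*-congʳ x≈0) (zeroˡ (v j)))) , u≋xv
    where
    u≋xv : u ≋ (u i * vᵢ⁻¹) *ᵥ v
    u≋xv j = *-cancelʳ vᵢ≉0 (begin
      u j * v i                  ≈⟨ x+y≈0⇒x≈y (polar≈0 j i) ⟩
      u i * v j                  ≈⟨ *-identityʳ (u i * v j) ⟨
      u i * v j * 1#             ≈⟨ *-congˡ vᵢ⁻¹vᵢ≈1 ⟨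
      u i * v j * (vᵢ⁻¹ * v i)
        ≈⟨ solve 4 (λ a b c d → a :* b :* (c :* d) := a :* c :* b :* d) refl (u i) (v j) vᵢ⁻¹ (v i) ⟩
      u i * vᵢ⁻¹ * v j * v i     ∎)

  ⊗-polar≈0 : ∀ u v → (u ⊗ v) 1F ≈ 0# → (u ⊗ v) 2F ≈ 0# → (u ⊗ v) 4F ≈ 0# → ∀ i j → polar u v i j ≈ 0#
  ⊗-polar≈0 u v ≈0₀₁ ≈0₀₂ ≈0₁₂ = λ
    { 0F 0F → x+x≈0 _ ; 0F 1F → ≈0₀₁ ; 0F 2F → ≈0₀₂
    ; 1F 0F → trans (+-comm _ _) ≈0₀₁ ; 1F 1F → x+x≈0 _ ; 1F 2F → ≈0₁₂
    ; 2F 0F → trans (+-comm _ _) ≈0₀₂ ; 2F 1F → trans (+-comm _ _) ≈0₁₂ ; 2F 2F → x+x≈0 _ }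

  module _ {n} {A B : Matrix n} (AB≈1 : A *ᴹ B ≈ᴹ 1ᴹ) where

    ᵥ*-Nonzero : ∀ {u} → Nonzero u → Nonzero (u ᵥ* A)
    ᵥ*-Nonzero {u} u≢0 uA≋0 = u≢0 λ j → begin
      u j               ≈⟨ ᵥ*-inverse {A = A} {B} AB≈1 u j ⟨
      (u ᵥ* A ᵥ* B) j   ≈⟨ ᵥ*-cong {u = u ᵥ* A} B uA≋0 j ⟩
      (0ᵥ ᵥ* B) j       ≈⟨ 0ᵥ-· (λ i → B i j) ⟩
      0#                ∎

    ᵥ*-∼ : ∀ {u v} → u ᵥ* A ∼ v ᵥ* A → u ∼ v
    ᵥ*-∼ {u} {v} (x , x≉0 , uA≋xvA) = x , x≉0 , λ j → begin
      u j                    ≈⟨ ᵥ*-inverse {A = A} {B} AB≈1 u j ⟨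
      (u ᵥ* A ᵥ* B) j        ≈⟨ ᵥ*-cong {u = u ᵥ* A} B uA≋xvA j ⟩
      ((x *ᵥ (v ᵥ* A)) ᵥ* B) j ≈⟨ *ᵥ-· x (v ᵥ* A) (λ i → B i j) ⟩
      x * (v ᵥ* A ᵥ* B) j    ≈⟨ *-congˡ (ᵥ*-inverse {A = A} {B} AB≈1 v j) ⟩
      x * v j                ∎

-- The image of the Artin-Schreier map

module ArtinSchreier {c ℓ : Level} (F : Field c ℓ) (1+1≈0 : HasCharacteristicTwo (Field.commutativeRing F))
  {q k : ℕ} (|F| : Field.setoid F HasCardinality q) (q≡2k : q ≡ k ℕ.+ k) where
  open Field F hiding (zero)
  open FiniteField F |F|
  open CharacteristicTwo commutativeRing 1+1≈0
  open CharacteristicTwoField F 1+1≈0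
  open Relation.Binary.Reasoning.Setoid setoid

  ∈℘? : Decidable ∈℘
  ∈℘? y = any? (λ s≈t ℘s≈y → trans (℘-cong (sym s≈t)) ℘s≈y) (λ t → ℘ t ≟ y)

  private
    |∈℘|′ : ∃ λ m → Subsetoid setoid ∈℘ HasCardinality m
    |∈℘|′ = subset-cardinality ∈℘-resp ∈℘?

    -- Choosing the root by the index of y makes the choice respect _≈_.
    rootᵢ : Fin q → Carrier
    rootᵢ i with ∈℘? (element i)
    ... | yes (t , _) = t
    ... | no  _       = 0#

    root : Carrier → Carrier
    root = rootᵢ ∘ index

    root-cong : ∀ {y z} → y ≈ z → root y ≈ root z
    root-cong y≈z = reflexive (≡.cong rootᵢ (Inverse.from-cong |F| y≈z))

    ℘-root : ∀ {y} → ∈℘ y → ℘ (root y) ≈ y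
    ℘-root {y} y∈℘ with ∈℘? (element (index y))
    ... | yes (t , ℘t≈y) = trans ℘t≈y (element-index y)
    ... | no  y∉℘        = contradiction (∈℘-resp (sym (element-index y)) y∈℘) y∉℘

    -- Each element of the image of ℘ has exactly the two preimages t and t + 1.
    ∈℘⊎∈℘↔F : Inverse (Subsetoid setoid ∈℘ ⊎ₛ Subsetoid setoid ∈℘) setoid
    ∈℘⊎∈℘↔F = bijection⇒inverse preimage cong injective surjective
      where
      S = Subsetoid setoid ∈℘ ⊎ₛ Subsetoid setoid ∈℘
      preimage : Setoid.Carrier S → Carrier
      preimage (inj₁ (y , _)) = root y
      preimage (inj₂ (y , _)) = root y + 1#
      value : Setoid.Carrier S → Carrier
      value = [ proj₁ , proj₁ ]′
      ℘-preimage : ∀ p → ℘ (preimage p) ≈ value p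
      ℘-preimage (inj₁ (y , y∈℘)) = ℘-root y∈℘
      ℘-preimage (inj₂ (y , y∈℘)) = trans (℘-+1 (root y)) (℘-root y∈℘)
      cong : Congruent (Setoid._≈_ S) _≈_ preimage
      cong (inj₁ y≈z) = root-cong y≈z
      cong (inj₂ y≈z) = +-congʳ (root-cong y≈z)
      t≉t+1 : ∀ {t} → ¬ t ≈ t + 1#
      t≉t+1 {t} t≈t+1 = 1≉0 (begin
        1#            ≈⟨ solve 1 (λ t → con true := t :+ (t :+ con true)) refl t ⟩
        t + (t + 1#)  ≈⟨ +-congˡ t≈t+1 ⟨
        t + t         ≈⟨ x+x≈0 t ⟩
        0#            ∎)
      value-≈ : ∀ p r → preimage p ≈ preimage r → value p ≈ value r
      value-≈ p r eq = trans (sym (℘-preimage p)) (trans (℘-cong eq) (℘-preimage r))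
      injective : Injective (Setoid._≈_ S) _≈_ preimage
      injective {p@(inj₁ _)} {r@(inj₁ _)} eq = inj₁ (value-≈ p r eq)
      injective {p@(inj₁ _)} {r@(inj₂ _)} eq =
        contradiction (trans (root-cong (sym (value-≈ p r eq))) eq) t≉t+1
      injective {p@(inj₂ _)} {r@(inj₁ _)} eq =
        contradiction (trans (root-cong (value-≈ p r eq)) (sym eq)) t≉t+1
      injective {p@(inj₂ _)} {r@(inj₂ _)} eq = inj₂ (value-≈ p r eq)
      surjective : StrictlySurjective _≈_ preimage
      surjective t with t ≟ root (℘ t)
      ... | yes t≈root = inj₁ (℘ t , t , refl) , sym t≈root
      ... | no  t≉root = inj₂ (℘ t , t , refl) , sym (℘-fibre (sym (℘-root (t , refl))) t≉root)

  |∈℘| : Subsetoid setoid ∈℘ HasCardinality k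
  |∈℘| with m , |∈℘|ₘ ← |∈℘|′ = ≡.subst (Subsetoid setoid ∈℘ HasCardinality_) m≡k |∈℘|ₘ
    where
    m≡k : m ≡ k
    m≡k = 2*-injective (≡.trans (cardinality-unique (cardinality-↔ ∈℘⊎∈℘↔F (cardinality-⊎ |∈℘|ₘ |∈℘|ₘ)) |F|) q≡2k)
      where
      2*-injective : ∀ {m n} → m ℕ.+ m ≡ n ℕ.+ n → m ≡ n
      2*-injective {m} {n} eq = ℕ.*-cancelˡ-≡ m n 2
        (≡.trans (≡.cong (m ℕ.+_) (ℕ.+-identityʳ m)) (≡.trans eq (≡.cong (n ℕ.+_) (≡.sym (ℕ.+-identityʳ n)))))

  |∉℘| : Subsetoid setoid (¬_ ∘ ∈℘) HasCardinality k
  |∉℘| = ≡.subst (Subsetoid setoid (¬_ ∘ ∈℘) HasCardinality_)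
    (≡.trans (≡.cong (ℕ._∸ k) q≡2k) (ℕ.m+n∸m≡n k k)) (complement-cardinality ∈℘-resp ∈℘? |∈℘|)

  -- Translation by y maps the image of `℘` injectively into its complement, which is equally large,
  -- hence onto it. So z = w + y with w in the image, and y + z = w.
  ∉℘-+ : ∀ {y z} → ¬ ∈℘ y → ¬ ∈℘ z → ∈℘ (y + z)
  ∉℘-+ {y} {z} y∉℘ z∉℘ = let (w , w∈℘) , w+y≈z = translate-surjective (z , z∉℘) in
    ∈℘-resp (begin
      w            ≈⟨ solve 2 (λ w y → w := y :+ (w :+ y)) refl w y ⟩
      y + (w + y)  ≈⟨ +-congˡ w+y≈z ⟩
      y + z        ∎) w∈℘
    where
    open Algebra.Properties.Group +-group using (∙-cancelʳ)
    translate : ∃ ∈℘ → ∃ (¬_ ∘ ∈℘)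
    translate (w , t , ℘t≈w) = w + y , λ (s , ℘s≈w+y) → y∉℘ (t + s , (begin
      ℘ (t + s)    ≈⟨ ℘-+ t s ⟩
      ℘ t + ℘ s    ≈⟨ +-cong ℘t≈w ℘s≈w+y ⟩
      w + (w + y)  ≈⟨ solve 2 (λ w y → w :+ (w :+ y) := y) refl w y ⟩
      y            ∎))
    translate-surjective : StrictlySurjective (Setoid._≈_ (Subsetoid setoid (¬_ ∘ ∈℘))) translate
    translate-surjective = injection⇒surjection |∈℘| |∉℘| {f = translate} +-congʳ (∙-cancelʳ y _ _) ℕ.≤-refl

-- The quadratic extension

module QuadraticExtension {c ℓ c′ ℓ′ : Level} {q m : ℕ} (q≡2^1+m : q ≡ 2 ℕ.^ suc m)
  (F : Field c ℓ) (|F| : Field.setoid F HasCardinality q)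
  (E : Field c′ ℓ′) (|E| : Field.setoid E HasCardinality (q ℕ.^ 2))
  (ι : RingHomomorphism (Field.rawRing F) (Field.rawRing E)) where
  open RingHomomorphism ι using (⟦_⟧; ⟦⟧-cong; +-homo; *-homo; 0#-homo; 1#-homo)

  1+1≈0 : HasCharacteristicTwo (Field.commutativeRing F)
  1+1≈0 = FiniteField.order≡2^k⇒1+1≈0 F |F| (suc m) q≡2^1+m

  1+1≈0ᴱ : HasCharacteristicTwo (Field.commutativeRing E)
  1+1≈0ᴱ = begin
    1# + 1#                  ≈⟨ +-cong 1#-homo 1#-homo ⟨
    ⟦ F.1# ⟧ + ⟦ F.1# ⟧      ≈⟨ +-homo F.1# F.1# ⟨
    ⟦ F.1# F.+ F.1# ⟧        ≈⟨ ⟦⟧-cong 1+1≈0 ⟩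
    ⟦ F.0# ⟧                 ≈⟨ 0#-homo ⟩
    0#                       ∎
    where
    module F = Field F
    open Field E
    open Relation.Binary.Reasoning.Setoid setoid

  q≡2^m+2^m : q ≡ 2 ℕ.^ m ℕ.+ 2 ℕ.^ m
  q≡2^m+2^m = ≡.trans q≡2^1+m (≡.cong (2 ℕ.^ m ℕ.+_) (ℕ.+-identityʳ (2 ℕ.^ m)))

  2≤q : 2 ≤ q
  2≤q = ≡.subst (2 ≤_) (≡.sym q≡2^1+m) (ℕ.*-monoʳ-≤ 2 (ℕ.>-nonZero⁻¹ (2 ℕ.^ m) {{ℕ.m^n≢0 2 m}}))

  private
    module F where
      open Field F public
      open FiniteField F |F| public
      open CharacteristicTwo commutativeRing 1+1≈0 public
      open CharacteristicTwoField F 1+1≈0 public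
      open ArtinSchreier F 1+1≈0 {k = 2 ℕ.^ m} |F| q≡2^m+2^m public

  open Field E hiding (zero)
  open FiniteField E |E|
  open CharacteristicTwo commutativeRing 1+1≈0ᴱ
  open CharacteristicTwoField E 1+1≈0ᴱ
  open Relation.Binary.Reasoning.Setoid setoid

  ⟦⟧≈0 : ∀ {x} → ⟦ x ⟧ ≈ 0# → x F.≈ F.0#
  ⟦⟧≈0 {x} ⟦x⟧≈0 = decidable-stable (x F.≟ F.0#) λ x≉0 → let x⁻¹ , x⁻¹x≈1 = F.inverse x≉0 in 1≉0 (begin
    1#                   ≈⟨ 1#-homo ⟨
    ⟦ F.1# ⟧             ≈⟨ ⟦⟧-cong x⁻¹x≈1 ⟨
    ⟦ x⁻¹ F.* x ⟧        ≈⟨ *-homo x⁻¹ x ⟩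
    ⟦ x⁻¹ ⟧ * ⟦ x ⟧      ≈⟨ *-congˡ ⟦x⟧≈0 ⟩
    ⟦ x⁻¹ ⟧ * 0#         ≈⟨ zeroʳ ⟦ x⁻¹ ⟧ ⟩
    0#                   ∎)

  ⟦⟧-injective : ∀ {x y} → ⟦ x ⟧ ≈ ⟦ y ⟧ → x F.≈ y
  ⟦⟧-injective {x} {y} ⟦x⟧≈⟦y⟧ = F.x+y≈0⇒x≈y (⟦⟧≈0 (begin
    ⟦ x F.+ y ⟧    ≈⟨ +-homo x y ⟩
    ⟦ x ⟧ + ⟦ y ⟧  ≈⟨ +-congʳ ⟦x⟧≈⟦y⟧ ⟩
    ⟦ y ⟧ + ⟦ y ⟧  ≈⟨ x+x≈0 ⟦ y ⟧ ⟩
    0#             ∎))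

  ⟦⟧-^ : ∀ x n → ⟦ x F.^ n ⟧ ≈ ⟦ x ⟧ ^ n
  ⟦⟧-^ x zero    = 1#-homo
  ⟦⟧-^ x (suc n) = trans (*-homo x (x F.^ n)) (*-congˡ (⟦⟧-^ x n))

  ⟦⟧-℘ : ∀ t → ⟦ F.℘ t ⟧ ≈ ℘ ⟦ t ⟧
  ⟦⟧-℘ t = trans (+-homo (t F.* t) t) (+-congʳ (*-homo t t))

  σ : Carrier → Carrier
  σ = _^ q

  σ-cong : ∀ {x y} → x ≈ y → σ x ≈ σ y
  σ-cong = ^-congˡ q

  σ-* : ∀ x y → σ (x * y) ≈ σ x * σ y
  σ-* x y = ^-distrib-* x y q

  σ-+ : ∀ x y → σ (x + y) ≈ σ x + σ y
  σ-+ x y = ≡.subst (λ n → (x + y) ^ n ≈ x ^ n + y ^ n) (≡.sym q≡2^1+m) (frobenius (suc m) x y)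

  σ-involutive : ∀ x → σ (σ x) ≈ x
  σ-involutive x = begin
    σ (σ x)        ≈⟨ ^-assocʳ x q q ⟩
    x ^ (q ℕ.* q)  ≡⟨ ≡.cong (λ n → x ^ (q ℕ.* n)) (ℕ.*-identityʳ q) ⟨
    x ^ (q ℕ.^ 2)  ≈⟨ fermat x ⟩
    x              ∎

  σ-⟦⟧ : ∀ x → σ ⟦ x ⟧ ≈ ⟦ x ⟧
  σ-⟦⟧ x = trans (sym (⟦⟧-^ x q)) (⟦⟧-cong (F.fermat x))

  -- A fixed x outside `F` would be, along with the q elements of `F`, one solution too many of T^q
  -- = T.
  σ-fixed⇒∈F : ∀ {x} → σ x ≈ x → ∃ λ t → ⟦ t ⟧ ≈ x
  σ-fixed⇒∈F {x} σx≈x = decidable-stable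
    (F.any? (λ t≈s ⟦t⟧≈x → trans (⟦⟧-cong (F.sym t≈s)) ⟦t⟧≈x) (λ t → ⟦ t ⟧ ≟ x))
    λ x∉F → ^-fixed-points 2≤q (z x∉F) (injective x∉F) (fixed x∉F)
    where
    module _ (x∉F : ¬ ∃ λ t → ⟦ t ⟧ ≈ x) where
      z : Fin (suc q) → Carrier
      z zero    = x
      z (suc i) = ⟦ F.element i ⟧
      injective : Injective _≡_ _≈_ z
      injective {zero}  {zero}  _  = ≡.refl
      injective {zero}  {suc j} eq = contradiction (F.element j , sym eq) x∉F
      injective {suc i} {zero}  eq = contradiction (F.element i , eq) x∉F
      injective {suc i} {suc j} eq = ≡.cong suc (F.element-injective (⟦⟧-injective eq))
      fixed : ∀ i → σ (z i) ≈ z i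
      fixed zero    = σx≈x
      fixed (suc i) = σ-⟦⟧ (F.element i)

  -- Otherwise any q + 1 of the q² elements of `E` would be solutions of T^q = T.
  σ-nontrivial : ∃ λ x → ¬ σ x ≈ x
  σ-nontrivial = decidable-stable
    (any? (λ x≈y σx≉x σy≈y → σx≉x (trans (σ-cong x≈y) (trans σy≈y (sym x≈y)))) (λ x → ¬? (σ x ≟ x)))
    λ trivial → ^-fixed-points 2≤q (λ i → element (inject≤ i q<q²))
      (Fin.inject≤-injective q<q² q<q² _ _ ∘ element-injective)
      (λ i → decidable-stable (_ ≟ _) λ σx≉x → trivial (_ , σx≉x))
    where
    q<q² : suc q ≤ q ℕ.^ 2
    q<q² = ≡.subst (q ℕ.<_) (≡.cong (q ℕ.*_) (≡.sym (ℕ.*-identityʳ q)))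
      (ℕ.m<m*n q q {{ℕ.>-nonZero (ℕ.<-trans (s≤s z≤n) 2≤q)}} 2≤q)

  -- A conjugate pair with trace 1 and norm in the image of ℘ on F would lie in F, where σ is trivial.
  norm∉℘ : ∀ {s y} → s + σ s ≈ 1# → s * σ s ≈ ⟦ y ⟧ → ¬ F.∈℘ y
  norm∉℘ {s} {y} trace norm (t , ℘t≈y) = 1≉0 (begin
    1#        ≈⟨ trace ⟨
    s + σ s   ≈⟨ +-congˡ (s-fixed (s ≟ ⟦ t ⟧)) ⟩
    s + s     ≈⟨ x+x≈0 s ⟩
    0#        ∎)
    where
    ℘s≈℘⟦t⟧ : ℘ s ≈ ℘ ⟦ t ⟧
    ℘s≈℘⟦t⟧ = begin
      ℘ s                     ≈⟨ ℘≈norm trace ⟩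
      s * σ s                 ≈⟨ norm ⟩
      ⟦ y ⟧                   ≈⟨ ⟦⟧-cong ℘t≈y ⟨
      ⟦ F.℘ t ⟧               ≈⟨ ⟦⟧-℘ t ⟩
      ℘ ⟦ t ⟧                 ∎
    s-fixed : Dec (s ≈ ⟦ t ⟧) → σ s ≈ s
    s-fixed (yes s≈t) = trans (σ-cong s≈t) (trans (σ-⟦⟧ t) (sym s≈t))
    s-fixed (no  s≉t) = trans (σ-cong s≈t+1) (trans (σ-⟦⟧ (t F.+ F.1#)) (sym s≈t+1))
      where
      s≈t+1 : s ≈ ⟦ t F.+ F.1# ⟧
      s≈t+1 = trans (℘-fibre ℘s≈℘⟦t⟧ s≉t) (trans (+-congˡ (sym 1#-homo)) (sym (+-homo t F.1#)))

  -- One such root is θ / (θ + σ θ) for any θ outside F; as the image of ℘ has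
  -- index two, translating it by F reaches every other y.
  conjugate-roots : ∀ {y} → ¬ F.∈℘ y → ∃ λ s → σ s ≈ s + 1# × ℘ s ≈ ⟦ y ⟧
  conjugate-roots {y} y∉℘ = let t , ℘t≈y₀+y = F.∉℘-+ y₀∉℘ y∉℘ in
    s₀ + ⟦ t ⟧ ,
    (begin
      σ (s₀ + ⟦ t ⟧)       ≈⟨ σ-+ s₀ ⟦ t ⟧ ⟩
      σ s₀ + σ ⟦ t ⟧       ≈⟨ +-cong σs₀≈s₀+1 (σ-⟦⟧ t) ⟩
      s₀ + 1# + ⟦ t ⟧      ≈⟨ solve 2 (λ s t → s :+ con true :+ t := s :+ t :+ con true) refl s₀ ⟦ t ⟧ ⟩
      s₀ + ⟦ t ⟧ + 1#      ∎) ,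
    (begin
      ℘ (s₀ + ⟦ t ⟧)       ≈⟨ ℘-+ s₀ ⟦ t ⟧ ⟩
      ℘ s₀ + ℘ ⟦ t ⟧       ≈⟨ +-cong (trans ℘s₀≈norm (sym ⟦y₀⟧≈norm)) (trans (sym (⟦⟧-℘ t)) (⟦⟧-cong ℘t≈y₀+y)) ⟩
      ⟦ y₀ ⟧ + ⟦ y₀ F.+ y ⟧  ≈⟨ +-homo y₀ (y₀ F.+ y) ⟨
      ⟦ y₀ F.+ (y₀ F.+ y) ⟧  ≈⟨ ⟦⟧-cong (F.solve 2 (λ y₀ y → y₀ F.:+ (y₀ F.:+ y) F.:= y) F.refl y₀ y) ⟩
      ⟦ y ⟧                ∎)
    where
    θ = proj₁ σ-nontrivial
    τ = θ + σ θ
    τ≉0 : ¬ τ ≈ 0#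
    τ≉0 τ≈0 = proj₂ σ-nontrivial (sym (x+y≈0⇒x≈y τ≈0))
    στ≈τ : σ τ ≈ τ
    στ≈τ = trans (σ-+ θ (σ θ)) (trans (+-congˡ (σ-involutive θ)) (+-comm (σ θ) θ))
    τ⁻¹ = proj₁ (inverse τ≉0)
    s₀ = θ * τ⁻¹
    s₀τ≈θ : s₀ * τ ≈ θ
    s₀τ≈θ = trans (*-assoc θ τ⁻¹ τ) (trans (*-congˡ (proj₂ (inverse τ≉0))) (*-identityʳ θ))
    σs₀≈s₀+1 : σ s₀ ≈ s₀ + 1#
    σs₀≈s₀+1 = *-cancelʳ τ≉0 (begin
      σ s₀ * τ        ≈⟨ *-congˡ στ≈τ ⟨
      σ s₀ * σ τ      ≈⟨ σ-* s₀ τ ⟨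
      σ (s₀ * τ)      ≈⟨ σ-cong s₀τ≈θ ⟩
      σ θ             ≈⟨ solve 2 (λ θ θ̄ → θ̄ := θ :+ (θ :+ θ̄)) refl θ (σ θ) ⟩
      θ + τ           ≈⟨ +-congʳ s₀τ≈θ ⟨
      s₀ * τ + τ      ≈⟨ solve 2 (λ s τ → s :* τ :+ τ := (s :+ con true) :* τ) refl s₀ τ ⟩
      (s₀ + 1#) * τ   ∎)
    norm-fixed : σ (s₀ * σ s₀) ≈ s₀ * σ s₀
    norm-fixed = trans (σ-* s₀ (σ s₀)) (trans (*-congˡ (σ-involutive s₀)) (*-comm (σ s₀) s₀))
    -- As `σ s₀` is s₀ + 1, `℘ s₀` is the norm of s₀; the norm is fixed by `σ`, so it comes from an
    -- element of `F`.
    y₀ = proj₁ (σ-fixed⇒∈F norm-fixed)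
    ⟦y₀⟧≈norm : ⟦ y₀ ⟧ ≈ s₀ * σ s₀
    ⟦y₀⟧≈norm = proj₂ (σ-fixed⇒∈F norm-fixed)
    ℘s₀≈norm : ℘ s₀ ≈ s₀ * σ s₀
    ℘s₀≈norm = trans (solve 1 (λ s → s :* s :+ s := s :* (s :+ con true)) refl s₀) (*-congˡ (sym σs₀≈s₀+1))
    y₀∉℘ : ¬ F.∈℘ y₀
    y₀∉℘ = norm∉℘ (trans (+-congˡ σs₀≈s₀+1) (solve 1 (λ s → s :+ (s :+ con true) := con true) refl s₀)) (sym ⟦y₀⟧≈norm)

-- Hyperplanes containing a line of o₁₂,₃

module NetForms {c ℓ : Level} (F : Field c ℓ) (1+1≈0 : HasCharacteristicTwo (Field.commutativeRing F))
  (_≟_ : Decidable₂ (Field._≈_ F)) where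
  open Field F hiding (zero)
  open FieldProperties F
  open CharacteristicTwo commutativeRing 1+1≈0
  open LinearAlgebra commutativeRing
  open Projective F
  open Relation.Binary.Reasoning.Setoid setoid

  parameters : Setoid c (c ⊔ ℓ)
  parameters = (setoid ⊎ₛ ≡.setoid ⊤) ⊎ₛ ((setoid ×ₛ setoid) ⊎ₛ (setoid ×ₛ (setoid ×ₛ setoid)))

  open Setoid parameters using () renaming (_≈_ to _≈ₚ_)

  coefficientwise : ∀ {f g : Vector Carrier 6} → f 0F ≈ g 0F → f 1F ≈ g 1F → f 2F ≈ g 2F →
    f 3F ≈ g 3F → f 4F ≈ g 4F → f 5F ≈ g 5F → f ≋ g
  coefficientwise e₀ e₁ e₂ e₃ e₄ e₅ = λ { 0F → e₀ ; 1F → e₁ ; 2F → e₂ ; 3F → e₃ ; 4F → e₄ ; 5F → e₅ }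

  form-cong : ∀ {p r} → p ≈ₚ r → form p ≋ form r
  form-cong (inj₁ (inj₁ d≈d′)) = coefficientwise refl refl refl refl refl d≈d′
  form-cong {inj₁ (inj₂ tt)} (inj₁ (inj₂ ≡.refl)) = λ _ → refl
  form-cong (inj₂ (inj₁ (a≈a′ , d≈d′))) = coefficientwise a≈a′ refl refl refl refl d≈d′
  form-cong (inj₂ (inj₂ (b≈b′ , d≈d′ , e≈e′))) =
    coefficientwise (+-cong (+-cong (+-cong (*-cong b≈b′ b≈b′) b≈b′) d≈d′) e≈e′) refl b≈b′ refl refl d≈d′

  form-Nonzero : ∀ p → Nonzero (form p)
  form-Nonzero (inj₁ (inj₁ d))  f≋0 = 1≉0 (f≋0 0F)
  form-Nonzero (inj₁ (inj₂ tt)) f≋0 = 1≉0 (f≋0 5F)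
  form-Nonzero (inj₂ (inj₁ _))  f≋0 = 1≉0 (f≋0 2F)
  form-Nonzero (inj₂ (inj₂ _))  f≋0 = 1≉0 (f≋0 1F)

  form-point : Parameter → Point 5
  form-point p = form p , form-Nonzero p

  -- Between different families, a coefficient that is 1 in one and 0 in the other excludes
  -- proportionality. Within a family with parameters, a common coefficient 1 forces the scalar to
  -- be 1.
  form-injective : ∀ {p r} → form p ∼ form r → p ≈ₚ r
  form-injective {p} {r} (x , x≉0 , eq) = compare p r eq
    where
    ¬1≈x0 : ¬ 1# ≈ x * 0#
    ¬1≈x0 1≈x0 = 1≉0 (trans 1≈x0 (zeroʳ x))
    ¬0≈x1 : ¬ 0# ≈ x * 1#
    ¬0≈x1 0≈x1 = x≉0 (sym (trans 0≈x1 (*-identityʳ x)))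
    unscale : 1# ≈ x * 1# → ∀ {y z} → y ≈ x * z → y ≈ z
    unscale 1≈x1 {y} {z} y≈xz = trans y≈xz (trans (*-congʳ (sym (trans 1≈x1 (*-identityʳ x)))) (*-identityˡ z))
    compare : ∀ p r → form p ≋ x *ᵥ form r → p ≈ₚ r
    compare (inj₁ (inj₁ d))  (inj₁ (inj₁ d′)) eq = inj₁ (inj₁ (unscale (eq 0F) (eq 5F)))
    compare (inj₁ (inj₁ d))  (inj₁ (inj₂ _))  eq = contradiction (eq 0F) ¬1≈x0
    compare (inj₁ (inj₂ _))  (inj₁ (inj₁ d′)) eq = contradiction (eq 0F) ¬0≈x1
    compare (inj₁ (inj₂ tt)) (inj₁ (inj₂ tt)) eq = inj₁ (inj₂ ≡.refl)
    compare (inj₁ (inj₁ d))  (inj₂ (inj₁ _))  eq = contradiction (eq 2F) ¬0≈x1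
    compare (inj₁ (inj₂ _))  (inj₂ (inj₁ _))  eq = contradiction (eq 2F) ¬0≈x1
    compare (inj₁ (inj₁ d))  (inj₂ (inj₂ _))  eq = contradiction (eq 3F) ¬0≈x1
    compare (inj₁ (inj₂ _))  (inj₂ (inj₂ _))  eq = contradiction (eq 3F) ¬0≈x1
    compare (inj₂ (inj₁ _))  (inj₁ (inj₁ _))  eq = contradiction (eq 2F) ¬1≈x0
    compare (inj₂ (inj₁ _))  (inj₁ (inj₂ _))  eq = contradiction (eq 2F) ¬1≈x0
    compare (inj₂ (inj₁ _))  (inj₂ (inj₁ _))  eq = inj₂ (inj₁ (unscale (eq 2F) (eq 0F) , unscale (eq 2F) (eq 5F)))
    compare (inj₂ (inj₁ _))  (inj₂ (inj₂ _))  eq = contradiction (eq 3F) ¬0≈x1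
    compare (inj₂ (inj₂ _))  (inj₁ (inj₁ _))  eq = contradiction (eq 3F) ¬1≈x0
    compare (inj₂ (inj₂ _))  (inj₁ (inj₂ _))  eq = contradiction (eq 3F) ¬1≈x0
    compare (inj₂ (inj₂ _))  (inj₂ (inj₁ _))  eq = contradiction (eq 3F) ¬1≈x0
    compare (inj₂ (inj₂ (b , d , e))) (inj₂ (inj₂ (b′ , d′ , e′))) eq = inj₂ (inj₂ (b≈b′ , d≈d′ , e≈e′))
      where
      b≈b′ = unscale (eq 3F) (eq 2F)
      d≈d′ = unscale (eq 3F) (eq 5F)
      e≈e′ : e ≈ e′
      e≈e′ = begin
        e                                      ≈⟨ isolate b d e ⟩
        b * b + b + d + (b * b + b + d + e)
          ≈⟨ +-cong (+-cong (+-cong (*-cong b≈b′ b≈b′) b≈b′) d≈d′) (unscale (eq 3F) (eq 0F)) ⟩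
        b′ * b′ + b′ + d′ + (b′ * b′ + b′ + d′ + e′)  ≈⟨ isolate b′ d′ e′ ⟨
        e′                                     ∎
        where
        isolate : ∀ b d e → e ≈ b * b + b + d + (b * b + b + d + e)
        isolate = solve 3 (λ b d e → e := b :* b :+ b :+ d :+ (b :* b :+ b :+ d :+ e)) refl

  -- The scalar is the first nonzero one among g₃, g₂, g₀, g₅: the place of a coefficient 1 in
  -- `form₃`, `form₂` and the two cases of `form₁`.
  normalise : ∀ {g} → Nonzero g → g 1F ≈ g 3F → g 3F ≈ g 4F → ∃ λ p → g ∼ form p
  normalise {g} g≢0 g₁≈g₃ g₃≈g₄ = by-cases (g 3F ≟ 0#) (g 2F ≟ 0#) (g 0F ≟ 0#)
    where
    module _ {x} (x≉0 : ¬ x ≈ 0#) where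
      x⁻¹ = proj₁ (inverse x≉0)
      scale : Carrier → Carrier
      scale y = x⁻¹ * y
      unscale : ∀ y → y ≈ x * scale y
      unscale y = begin
        y              ≈⟨ *-identityˡ y ⟨
        1# * y         ≈⟨ *-congʳ (proj₂ (inverse x≉0)) ⟨
        x⁻¹ * x * y    ≈⟨ *-congʳ (*-comm x⁻¹ x) ⟩
        x * x⁻¹ * y    ≈⟨ *-assoc x x⁻¹ y ⟩
        x * (x⁻¹ * y)  ∎
    ≈x1 : ∀ {x y} → y ≈ x → y ≈ x * 1#
    ≈x1 {x} y≈x = trans y≈x (sym (*-identityʳ x))
    ≈x0 : ∀ {x y} → y ≈ 0# → y ≈ x * 0#
    ≈x0 {x} y≈0 = trans y≈0 (sym (zeroʳ x))
    by-cases : Dec (g 3F ≈ 0#) → Dec (g 2F ≈ 0#) → Dec (g 0F ≈ 0#) → ∃ λ p → g ∼ form p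
    -- e is chosen by solving a = b² + b + d + e for it, in characteristic two.
    by-cases (no g₃≉0) _ _ = inj₂ (inj₂ (b , d , b * b + b + d + a)) , g 3F , g₃≉0 ,
      coefficientwise
        (trans (unscale g₃≉0 (g 0F)) (*-congˡ (solve 3
          (λ a b d → a := b :* b :+ b :+ d :+ (b :* b :+ b :+ d :+ a)) refl a b d)))
        (≈x1 g₁≈g₃) (unscale g₃≉0 (g 2F)) (≈x1 refl) (≈x1 (sym g₃≈g₄)) (unscale g₃≉0 (g 5F))
      where
      a = scale g₃≉0 (g 0F)
      b = scale g₃≉0 (g 2F)
      d = scale g₃≉0 (g 5F)
    by-cases (yes g₃≈0) (no g₂≉0) _ =
      inj₂ (inj₁ (scale g₂≉0 (g 0F) , scale g₂≉0 (g 5F))) , g 2F , g₂≉0 ,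
      coefficientwise (unscale g₂≉0 (g 0F)) (≈x0 (trans g₁≈g₃ g₃≈0)) (≈x1 refl)
        (≈x0 g₃≈0) (≈x0 (trans (sym g₃≈g₄) g₃≈0)) (unscale g₂≉0 (g 5F))
    by-cases (yes g₃≈0) (yes g₂≈0) (no g₀≉0) = inj₁ (inj₁ (scale g₀≉0 (g 5F))) , g 0F , g₀≉0 ,
      coefficientwise (≈x1 refl) (≈x0 (trans g₁≈g₃ g₃≈0)) (≈x0 g₂≈0)
        (≈x0 g₃≈0) (≈x0 (trans (sym g₃≈g₄) g₃≈0)) (unscale g₀≉0 (g 5F))
    by-cases (yes g₃≈0) (yes g₂≈0) (yes g₀≈0) = inj₁ (inj₂ tt) , g 5F ,
      (λ g₅≈0 → g≢0 (coefficientwise g₀≈0 (trans g₁≈g₃ g₃≈0) g₂≈0 g₃≈0 (trans (sym g₃≈g₄) g₃≈0) g₅≈0)) ,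
      coefficientwise (≈x0 g₀≈0) (≈x0 (trans g₁≈g₃ g₃≈0)) (≈x0 g₂≈0)
        (≈x0 g₃≈0) (≈x0 (trans (sym g₃≈g₄) g₃≈0)) (≈x1 refl)

-- Hyperplanes through the line and their normal forms

module NetHyperplanes {c ℓ : Level} (F : Field c ℓ) (1+1≈0 : HasCharacteristicTwo (Field.commutativeRing F))
  (_≟_ : Decidable₂ (Field._≈_ F)) where
  open Field F hiding (zero)
  open FieldProperties F
  open CharacteristicTwo commutativeRing 1+1≈0
  open NetForms F 1+1≈0 _≟_
  open LinearAlgebra commutativeRing
  open Projective F
  open Relation.Binary.Reasoning.Setoid setoid

  Inverses : Matrix 3 → Matrix 3 → Set ℓ
  Inverses A B = A *ᴹ B ≈ᴹ 1ᴹ × B *ᴹ A ≈ᴹ 1ᴹ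

  -- Substitution and rescaling are combined, so that one condition covers both the transport to the
  -- representative and the normalisation.
  Invariant : ∀ {h} → Pred Hyperplane h → Set (c ⊔ ℓ ⊔ h)
  Invariant 𝓗 = ∀ A B x → Inverses A B → ¬ x ≈ 0# → ∀ H H′ →
    coords H′ ≋ x *ᵥ substitute A (coords H) → 𝓗 H → 𝓗 H′

  substitute-cong : ∀ A {f g} → f ≋ g → substitute A f ≋ substitute A g
  substitute-cong A = ᵥ*-cong (row-products A)

  substitute-*ᵥ : ∀ A x f → substitute A (x *ᵥ f) ≋ x *ᵥ substitute A f
  substitute-*ᵥ A x f j = *ᵥ-· x f (λ i → row-products A i j)

  module _ {A B : Matrix 3} (AB≈1 : A *ᴹ B ≈ᴹ 1ᴹ) where

    substitute-Nonzero : ∀ {f} → Nonzero f → Nonzero (substitute A f)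
    substitute-Nonzero {f} f≢0 fA≋0 = f≢0 λ j → begin
      f j                            ≈⟨ substitute-inverse {A} {B} AB≈1 f j ⟨
      substitute B (substitute A f) j  ≈⟨ substitute-cong B {substitute A f} fA≋0 j ⟩
      substitute B 0ᵥ j              ≈⟨ 0ᵥ-· (λ i → row-products B i j) ⟩
      0#                             ∎

    substitute-∼ : ∀ {f g} → substitute A f ∼ g → f ∼ substitute B g
    substitute-∼ {f} {g} (x , x≉0 , fA≋xg) = x , x≉0 , λ j → begin
      f j                            ≈⟨ substitute-inverse {A} {B} AB≈1 f j ⟨
      substitute B (substitute A f) j  ≈⟨ substitute-cong B {substitute A f} fA≋xg j ⟩
      substitute B (x *ᵥ g) j        ≈⟨ substitute-*ᵥ B x g j ⟩
      x * substitute B g j           ∎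

  module _ (L : Line 5) {A B : Matrix 3} (inverses : Inverses A B)
    (L≐ : points L ≐ Image A representative₁₂,₃) where
    private
      AB≈1 = proj₁ inverses
      BA≈1 = proj₂ inverses

    -- The vector with entries `row-products A i · z` is the image of z under M ↦ AMAᵀ, by `⊗-·`.
    ·-image : ∀ f z → (f · λ i → row-products A i · z) ≈ substitute A f · z
    ·-image f z = sym (ᵥ*-· f (row-products A) z)

    -- Containment is tested at the images of the points (1, 0) and (0, 1) of the representative,
    -- where the pairing gives g₁ + g₃ and g₃ + g₄.
    contains⇒net : ∀ {H : Hyperplane} → Contains L H → let g = substitute A (coords H) in g 1F ≈ g 3F × g 3F ≈ g 4F
    contains⇒net {H} L⊆H =
      x+y≈0⇒x≈y (begin
        g 1F + g 3F
          ≈⟨ solve 2 (λ x y → x := x :* con true :+ y :* con false) refl (g 1F + g 3F) (g 3F + g 4F) ⟩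
        (g 1F + g 3F) * 1# + (g 3F + g 4F) * 0#          ≈⟨ ·-net-point g e₀ ⟨
        g · net-point e₀                                 ≈⟨ vanishes e₀ (λ w≋0 → 1≉0 (w≋0 0F)) ⟩
        0#                                               ∎) ,
      x+y≈0⇒x≈y (begin
        g 3F + g 4F
          ≈⟨ solve 2 (λ x y → y := x :* con false :+ y :* con true) refl (g 1F + g 3F) (g 3F + g 4F) ⟩
        (g 1F + g 3F) * 0# + (g 3F + g 4F) * 1#          ≈⟨ ·-net-point g e₁ ⟨
        g · net-point e₁                                 ≈⟨ vanishes e₁ (λ w≋0 → 1≉0 (w≋0 1F)) ⟩
        0#                                               ∎)
      where
      e₀ e₁ : Vector Carrier 2
      e₀ = 1# ∷ 0# ∷ []
      e₁ = 0# ∷ 1# ∷ []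
      g = substitute A (coords H)
      vanishes : ∀ w → Nonzero w → g · net-point w ≈ 0#
      vanishes w w≢0 = trans (sym (·-image (coords H) z)) (L⊆H (p , p≢0) (proj₂ L≐ {p , p≢0} p∈Image))
        where
        z = net-point w
        z≢0 : Nonzero z
        z≢0 z≋0 = w≢0 λ { 0F → z≋0 1F ; 1F → z≋0 4F }
        p : Vector Carrier 6
        p i = row-products A i · z
        p≢0 : Nonzero p
        -- Each coordinate of z is recovered from p: the i-th coordinate functional is the
        -- substitute by A of its substitute by B, and the adjunction moves A over to z.
        p≢0 p≋0 = z≢0 λ i → begin
          z i                                         ≈⟨ 1ᴹ-· i z ⟨
          1ᴹ i · z
            ≈⟨ ·-cong {u = 1ᴹ i} {substitute A (substitute B (1ᴹ i))} {z} {z} (λ j → sym (substitute-inverse {B} {A} BA≈1 (1ᴹ i) j)) (λ _ → refl) ⟩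
          substitute A (substitute B (1ᴹ i)) · z      ≈⟨ ·-image (substitute B (1ᴹ i)) z ⟨
          substitute B (1ᴹ i) · p
            ≈⟨ ·-cong {u = substitute B (1ᴹ i)} {substitute B (1ᴹ i)} {p} {0ᵥ} (λ _ → refl) p≋0 ⟩
          substitute B (1ᴹ i) · 0ᵥ                    ≈⟨ ·-0ᵥ (substitute B (1ᴹ i)) ⟩
          0#                                          ∎
        p∈Image : (p , p≢0) ∈ Image A representative₁₂,₃
        p∈Image = (z , z≢0) , ((w , w≢0) , ∼-refl) , 1# , 1≉0 , λ i j →
          trans (entry i j) (sym (*-identityˡ _))
          where
          entry : symmetricMatrix p ≈ᴹ A *ᴹ symmetricMatrix z *ᴹ transpose A
          entry = λ
            { 0F 0F → ⊗-· A z 0F 0F ; 0F 1F → ⊗-· A z 0F 1F ; 0F 2F → ⊗-· A z 0F 2F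
            ; 1F 0F → trans (⊗-comm 0F 1F) (⊗-· A z 1F 0F) ; 1F 1F → ⊗-· A z 1F 1F ; 1F 2F → ⊗-· A z 1F 2F
            ; 2F 0F → trans (⊗-comm 0F 2F) (⊗-· A z 2F 0F) ; 2F 1F → trans (⊗-comm 1F 2F) (⊗-· A z 2F 1F)
            ; 2F 2F → ⊗-· A z 2F 2F }
            where
            ⊗-comm : ∀ i j → (A i ⊗ A j) · z ≈ (A j ⊗ A i) · z
            ⊗-comm i j = ·-cong {u = A i ⊗ A j} {A j ⊗ A i} {z} {z} (coefficientwise
              (commute 0F) (swap 0F 1F) (swap 0F 2F) (commute 1F) (swap 1F 2F) (commute 2F)) (λ _ → refl)
              where
              commute : ∀ k → A i k * A j k ≈ A j k * A i k
              commute k = *-comm (A i k) (A j k)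
              swap : ∀ k l → A i k * A j l + A i l * A j k ≈ A j k * A i l + A j l * A i k
              swap k l = solve 4 (λ a b c d → a :* d :+ b :* c := c :* b :+ d :* a) refl (A i k) (A i l) (A j k) (A j l)

    net⇒contains : ∀ {H : Hyperplane} {p} → substitute A (coords H) ≋ form p → Contains L H
    net⇒contains {H} {p} HA≋p P P∈L with proj₁ L≐ {P} P∈L
    ... | z , (w , y , y≉0 , z≋yw) , x , x≉0 , P≈xAzAᵀ = begin
      coords H · coords P
        ≈⟨ ·-cong {u = coords H} {coords H} {coords P} {x *ᵥ v} (λ _ → refl) P≋ ⟩
      coords H · (x *ᵥ v)  ≈⟨ ·-*ᵥ (coords H) x v ⟩
      x * (coords H · v)  ≈⟨ *-congˡ (·-image (coords H) (coords z)) ⟩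
      x * (substitute A (coords H) · coords z)
        ≈⟨ *-congˡ (·-cong {u = substitute A (coords H)} {form p} {coords z} {y *ᵥ net-point (coords w)} HA≋p z≋yw) ⟩
      x * (form p · (y *ᵥ net-point (coords w)))     ≈⟨ *-congˡ (·-*ᵥ (form p) y (net-point (coords w))) ⟩
      x * (y * (form p · net-point (coords w)))      ≈⟨ *-congˡ (*-congˡ (·-net-point (form p) (coords w))) ⟩
      x * (y * ((form p 1F + form p 3F) * coords w 0F + (form p 3F + form p 4F) * coords w 1F))
        ≈⟨ *-congˡ (*-congˡ (+-cong (*-congʳ (+-congʳ (proj₁ (form-net p)))) (*-congʳ (+-congʳ (proj₂ (form-net p)))))) ⟩
      x * (y * ((form p 3F + form p 3F) * coords w 0F + (form p 4F + form p 4F) * coords w 1F))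
        ≈⟨ solve 6 (λ x y a b u v → x :* (y :* ((a :+ a) :* u :+ (b :+ b) :* v)) := con false) refl
             x y (form p 3F) (form p 4F) (coords w 0F) (coords w 1F) ⟩
      0#                                             ∎
      where
      v : Vector Carrier 6
      v i = row-products A i · coords z
      entry : ∀ {i j} k → coords P k ≈ symmetricMatrix (coords P) i j → coords P k ≈ x * ((A i ⊗ A j) · coords z)
      entry {i} {j} k eq = trans eq (trans (P≈xAzAᵀ i j) (*-congˡ (sym (⊗-· A (coords z) i j))))
      P≋ : coords P ≋ x *ᵥ v
      P≋ = coefficientwise (entry {0F} {0F} 0F refl) (entry {0F} {1F} 1F refl) (entry {0F} {2F} 2F refl)
        (entry {1F} {1F} 3F refl) (entry {1F} {2F} 4F refl) (entry {2F} {2F} 5F refl)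

    -- p ↦ `substitute B (form p)` is a bijection from the parameters to the hyperplanes through L:
    -- `normalise` makes it surjective, `form-injective` injective. Invariance lets membership in a
    -- class be tested on the normal form.
    number-containing : ∀ {h r n} {𝓗 : Pred Hyperplane h} {P : Pred Parameter r} → Invariant 𝓗 →
      (∀ p → 𝓗 (form-point p) → P p) → (∀ p → P p → 𝓗 (form-point p)) →
      Subsetoid parameters P HasCardinality n →
      Subsetoid (PG 5) (λ H → 𝓗 H × H ∈ Contains L) HasCardinality n
    number-containing {𝓗 = 𝓗} {P} invariant 𝓗⇒P P⇒𝓗 = cardinality-↔ (bijection⇒inverse
      (λ (p , Pp) → hyperplane p , hyperplane∈𝓗 p Pp , L⊆hyperplane p)
      (λ {(p , _)} {(r , _)} → hyperplane-cong p r) (λ {(p , _)} {(r , _)} → hyperplane-injective p r) surjective)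
      where
      hyperplane : Parameter → Hyperplane
      hyperplane p = substitute B (form p) , substitute-Nonzero {B} {A} BA≈1 {form p} (form-Nonzero p)
      hyperplane∈𝓗 : ∀ p → P p → 𝓗 (hyperplane p)
      hyperplane∈𝓗 p Pp = invariant B A 1# (BA≈1 , AB≈1) 1≉0 (form-point p) (hyperplane p)
        (λ j → sym (*-identityˡ _)) (P⇒𝓗 p Pp)
      L⊆hyperplane : ∀ p → Contains L (hyperplane p)
      L⊆hyperplane p = net⇒contains {hyperplane p} {p} (substitute-inverse {B} {A} BA≈1 (form p))
      hyperplane-cong : ∀ p r → Setoid._≈_ parameters p r → coords (hyperplane p) ∼ coords (hyperplane r)
      hyperplane-cong p r p≈r = 1# , 1≉0 , λ j →
        trans (substitute-cong B {form p} {form r} (form-cong p≈r) j) (sym (*-identityˡ _))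
      hyperplane-injective : ∀ p r → coords (hyperplane p) ∼ coords (hyperplane r) → Setoid._≈_ parameters p r
      hyperplane-injective p r pB∼rB = form-injective {p} {r}
        (∼-trans {u = form p} {substitute A (substitute B (form r))} {form r}
        (substitute-∼ {B} {A} BA≈1 {form p} {substitute B (form r)} pB∼rB)
        (1# , 1≉0 , λ j → trans (substitute-inverse {B} {A} BA≈1 (form r) j) (sym (*-identityˡ _))))
      surjective : ∀ ((H , _) : ∃ λ H → 𝓗 H × H ∈ Contains L) →
        ∃ λ ((p , _) : ∃ P) → coords (hyperplane p) ∼ coords H
      surjective (H , H∈𝓗 , L⊆H) =
        let p , HA∼p = normalise {substitute A (coords H)} (substitute-Nonzero {A} {B} AB≈1 {coords H} (proj₂ H))
              (proj₁ (contains⇒net {H} L⊆H)) (proj₂ (contains⇒net {H} L⊆H))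
            x , x≉0 , p≋xHA = ∼-sym {v = substitute A (coords H)} {form p} HA∼p
        in (p , 𝓗⇒P p (invariant A B x inverses x≉0 H (form-point p) p≋xHA H∈𝓗)) ,
           ∼-sym {v = coords H} {substitute B (form p)} (substitute-∼ {A} {B} AB≈1 {coords H} {form p} HA∼p)

-- The four classes of hyperplanes

module Totals {q k : ℕ} (q≡k+k : q ≡ k ℕ.+ k) (1≤q : 1 ≤ q) where
  open ≡.≡-Reasoning

  private
    -- The number of pairs (a, d) with ad outside the image of `℘`: q - 1 choices of a, then k
    -- values of ad.
    r : ℕ
    r = (q ℕ.∸ 1) ℕ.* k

    q/2≡k : q ℕ./ 2 ≡ k
    q/2≡k = ≡.trans
      (≡.cong (ℕ._/ 2) (≡.trans q≡k+k (≡.sym (≡.trans (ℕ.*-comm k 2) (≡.cong (k ℕ.+_) (ℕ.+-identityʳ k))))))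
      (m*n/n≡m k 2)

    q²≡qq : q ℕ.^ 2 ≡ q ℕ.* q
    q²≡qq = ≡.cong (q ℕ.*_) (ℕ.*-identityʳ q)

    -- The left side counts the triples (b, d, e) with d in the image of `℘`, or with d outside it;
    -- the factor 1 stands for e = 0.
    qk≡r+k : q ℕ.* (k ℕ.* 1) ≡ r ℕ.+ k
    qk≡r+k = begin
      q ℕ.* (k ℕ.* 1)        ≡⟨ ≡.cong (q ℕ.*_) (ℕ.*-identityʳ k) ⟩
      q ℕ.* k                ≡⟨ ≡.cong (ℕ._* k) (ℕ.m∸n+n≡m 1≤q) ⟨
      (q ℕ.∸ 1 ℕ.+ 1) ℕ.* k  ≡⟨ ℕ.*-distribʳ-+ k (q ℕ.∸ 1) 1 ⟩
      r ℕ.+ 1 ℕ.* k          ≡⟨ ≡.cong (r ℕ.+_) (ℕ.*-identityˡ k) ⟩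
      r ℕ.+ k                ∎

    -- Makes the truncated difference q² ∸ r exact.
    r≤qq : r ≤ q ℕ.* q
    r≤qq = ℕ.*-mono-≤ (ℕ.m∸n≤m q 1) (≡.subst (k ≤_) (≡.sym q≡k+k) (ℕ.m≤m+n k k))

  total₂ᵣ : (q ℕ.* q ℕ.∸ r) ℕ.+ q ℕ.* (k ℕ.* 1) ≡ q ℕ.^ 2 ℕ.+ q ℕ./ 2
  total₂ᵣ = begin
    (q ℕ.* q ℕ.∸ r) ℕ.+ q ℕ.* (k ℕ.* 1)  ≡⟨ ≡.cong ((q ℕ.* q ℕ.∸ r) ℕ.+_) qk≡r+k ⟩
    (q ℕ.* q ℕ.∸ r) ℕ.+ (r ℕ.+ k)        ≡⟨ ℕ.+-assoc (q ℕ.* q ℕ.∸ r) r k ⟨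
    (q ℕ.* q ℕ.∸ r) ℕ.+ r ℕ.+ k          ≡⟨ ≡.cong (ℕ._+ k) (ℕ.m∸n+n≡m r≤qq) ⟩
    q ℕ.* q ℕ.+ k                        ≡⟨ ≡.cong₂ ℕ._+_ q²≡qq q/2≡k ⟨
    q ℕ.^ 2 ℕ.+ q ℕ./ 2                  ∎

  -- Twice r + k is 2qk = q², and the left side falls short of it by k.
  total₂ᵢ : r ℕ.+ q ℕ.* (k ℕ.* 1) ≡ q ℕ.^ 2 ℕ.∸ q ℕ./ 2
  total₂ᵢ = begin
    r ℕ.+ q ℕ.* (k ℕ.* 1)                ≡⟨ ≡.cong (r ℕ.+_) qk≡r+k ⟩
    r ℕ.+ (r ℕ.+ k)                      ≡⟨ ℕ.m+n∸n≡m (r ℕ.+ (r ℕ.+ k)) k ⟨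
    r ℕ.+ (r ℕ.+ k) ℕ.+ k ℕ.∸ k
      ≡⟨ ≡.cong (ℕ._∸ k) (solve 2 (λ r k → r :+ (r :+ k) :+ k := (r :+ k) :+ (r :+ k)) ≡.refl r k) ⟩
    (r ℕ.+ k) ℕ.+ (r ℕ.+ k) ℕ.∸ k
      ≡⟨ ≡.cong (λ n → n ℕ.+ n ℕ.∸ k) (≡.trans (≡.sym qk≡r+k) (≡.cong (q ℕ.*_) (ℕ.*-identityʳ k))) ⟩
    q ℕ.* k ℕ.+ q ℕ.* k ℕ.∸ k            ≡⟨ ≡.cong (ℕ._∸ k) (ℕ.*-distribˡ-+ q k k) ⟨
    q ℕ.* (k ℕ.+ k) ℕ.∸ k                ≡⟨ ≡.cong (λ n → q ℕ.* n ℕ.∸ k) q≡k+k ⟨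
    q ℕ.* q ℕ.∸ k                        ≡⟨ ≡.cong₂ ℕ._∸_ q²≡qq q/2≡k ⟨
    q ℕ.^ 2 ℕ.∸ q ℕ./ 2                  ∎
    where open +-*-Solver

  total₃ : q ℕ.* (q ℕ.* (q ℕ.∸ 1)) ≡ q ℕ.^ 3 ℕ.∸ q ℕ.^ 2
  total₃ = begin
    q ℕ.* (q ℕ.* (q ℕ.∸ 1))              ≡⟨ ≡.cong (q ℕ.*_) (ℕ.*-distribˡ-∸ q q 1) ⟩
    q ℕ.* (q ℕ.* q ℕ.∸ q ℕ.* 1)          ≡⟨ ℕ.*-distribˡ-∸ q (q ℕ.* q) (q ℕ.* 1) ⟩
    q ℕ.* (q ℕ.* q) ℕ.∸ q ℕ.* (q ℕ.* 1)  ≡⟨ ≡.cong (λ n → q ℕ.* n ℕ.∸ q ℕ.^ 2) q²≡qq ⟨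
    q ℕ.^ 3 ℕ.∸ q ℕ.^ 2                  ∎

module HyperplaneClasses {c ℓ c′ ℓ′ : Level} {q m : ℕ} (q≡2^1+m : q ≡ 2 ℕ.^ suc m)
  (F : Field c ℓ) (|F| : Field.setoid F HasCardinality q)
  (E : Field c′ ℓ′) (|E| : Field.setoid E HasCardinality (q ℕ.^ 2))
  (ι : RingHomomorphism (Field.rawRing F) (Field.rawRing E)) where
  open RingHomomorphism ι using (⟦_⟧; ⟦⟧-cong; +-homo; *-homo; 0#-homo; 1#-homo)
  open QuadraticExtension {m = m} q≡2^1+m F |F| E |E| ι

  private
    module E where
      open Field E public
      open FiniteField E |E| public
      open LinearAlgebra commutativeRing public
      open Projective E public
      open CharacteristicTwo commutativeRing 1+1≈0ᴱ public
      open CharacteristicTwoField E 1+1≈0ᴱ public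
      open Relation.Binary.Reasoning.Setoid setoid public

  open Field F hiding (zero)
  open FiniteField F |F|
  open LinearAlgebra commutativeRing
  open Projective F
  open HyperplaneOrbits q F E ι using (H₂ᵢ)
  open CharacteristicTwo commutativeRing 1+1≈0
  open CharacteristicTwoField F 1+1≈0
  open ArtinSchreier F 1+1≈0 {k = 2 ℕ.^ m} |F| q≡2^m+2^m
  open NetForms F 1+1≈0 _≟_
  open NetHyperplanes F 1+1≈0 _≟_
  open Relation.Binary.Reasoning.Setoid setoid

  -- Double lines

  H₁-invariant : Invariant H₁
  H₁-invariant A _ x _ _ H H′ H′≋xHA (y , u , H≋yu²) =
    x * y , u ᵥ* A , substitute-scaled-⊗ {A} {x} {y} {coords H} {coords H′} {u} {u} H′≋xHA H≋yu²

  -- P₁, P₂ᵣ, P₂ᵢ and P₃ hold of the parameters of the forms in H₁, H₂ᵣ, H₂ᵢ and H₃.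
  P₁ : Pred Parameter 0ℓ
  P₁ (inj₁ _) = Polymorphic.⊤
  P₁ (inj₂ _) = ⊥

  -- A multiple of a square has no mixed terms in characteristic two, whereas `form₂` and `form₃`
  -- have a mixed coefficient 1.
  H₁⇒P₁ : ∀ p → H₁ (form-point p) → P₁ p
  H₁⇒P₁ (inj₁ _) _ = _
  H₁⇒P₁ (inj₂ p) (x , u , f≋xu²) = contradiction (1≈0 p f≋xu²) 1≉0
    where
    mixed≈0 : ∀ i j → x * (u i * u j + u j * u i) ≈ 0#
    mixed≈0 i j = solve 3 (λ x a b → x :* (a :* b :+ b :* a) := con false) refl x (u i) (u j)
    1≈0 : ∀ p → form (inj₂ p) ≋ x *ᵥ (u ⊗ u) → 1# ≈ 0#
    1≈0 (inj₁ _) f≋xu² = trans (f≋xu² 2F) (mixed≈0 0F 2F)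
    1≈0 (inj₂ _) f≋xu² = trans (f≋xu² 4F) (mixed≈0 1F 2F)

  P₁⇒H₁ : ∀ p → P₁ p → H₁ (form-point p)
  P₁⇒H₁ (inj₁ (inj₁ d)) _ = 1# , (1# ∷ 0# ∷ √d ∷ []) , coefficientwise
    (solve 0 (i := i :* (i :* i)) refl)
    (solve 0 (o := i :* (i :* o :+ o :* i)) refl)
    (solve 1 (λ s → o := i :* (i :* s :+ s :* i)) refl √d)
    (solve 0 (o := i :* (o :* o)) refl)
    (solve 1 (λ s → o := i :* (o :* s :+ s :* o)) refl √d)
    (begin
      d                                  ≈⟨ fermat d ⟨
      d ^ q                              ≡⟨ ≡.cong (d ^_) q≡2^m+2^m ⟩
      d ^ (2 ℕ.^ m ℕ.+ 2 ℕ.^ m)          ≈⟨ ^-homo-* d (2 ℕ.^ m) (2 ℕ.^ m) ⟩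
      √d * √d                            ≈⟨ *-identityˡ (√d * √d) ⟨
      1# * (√d * √d)                     ∎)
    where
    -- The square of d^(q/2) is d^q = d, so X² + dZ² is the square of X + √d Z.
    √d = d ^ (2 ℕ.^ m)
    o i : ∀ {n} → Polynomial n
    o = con false
    i = con true
  P₁⇒H₁ (inj₁ (inj₂ tt)) _ = 1# , (0# ∷ 0# ∷ 1# ∷ []) , coefficientwise
    (solve 0 (o := i :* (o :* o)) refl) (solve 0 (o := i :* (o :* o :+ o :* o)) refl)
    (solve 0 (o := i :* (o :* i :+ i :* o)) refl) (solve 0 (o := i :* (o :* o)) refl)
    (solve 0 (o := i :* (o :* i :+ i :* o)) refl) (solve 0 (i := i :* (i :* i)) refl)
    where
    o i : ∀ {n} → Polynomial n
    o = con false
    i = con true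

  -- Non-singular conics

  H₃⇒discriminant≉0 : ∀ {H} → H₃ H → ¬ discriminant (coords H) ≈ 0#
  H₃⇒discriminant≉0 {H} H∈H₃ disc≈0 = H∈H₃ (trans (discriminant-formula (coords H)) disc≈0)

  discriminant≉0⇒H₃ : ∀ {H} → ¬ discriminant (coords H) ≈ 0# → H₃ H
  discriminant≉0⇒H₃ {H} disc≉0 disc≈0 = disc≉0 (trans (sym (discriminant-formula (coords H))) disc≈0)

  -- Substituting B back expresses x³ times the discriminant of H as a multiple of that of H′, so
  -- that only the nonzero x has to be cancelled.
  H₃-invariant : Invariant H₃
  H₃-invariant A B x (AB≈1 , _) x≉0 H H′ H′≋xHA H∈H₃ =
    discriminant≉0⇒H₃ {H′} λ disc′≈0 → H₃⇒discriminant≉0 {H} H∈H₃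
      (integral (*≉0 (*≉0 x≉0 x≉0) x≉0) (begin
        x * x * x * discriminant (coords H)                ≈⟨ discriminant-*ᵥ x (coords H) ⟨
        discriminant (x *ᵥ coords H)
          ≈⟨ discriminant-cong {substitute B (coords H′)} {x *ᵥ coords H} H′B≋xH ⟨
        discriminant (substitute B (coords H′))            ≈⟨ discriminant-substitute B (coords H′) ⟩
        determinant B * determinant B * discriminant (coords H′)  ≈⟨ *-congˡ disc′≈0 ⟩
        determinant B * determinant B * 0#                 ≈⟨ zeroʳ _ ⟩
        0#                                                 ∎))
    where
    H′B≋xH : substitute B (coords H′) ≋ x *ᵥ coords H
    H′B≋xH j = begin
      substitute B (coords H′) j
        ≈⟨ substitute-cong B {coords H′} {x *ᵥ substitute A (coords H)} H′≋xHA j ⟩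
      substitute B (x *ᵥ substitute A (coords H)) j    ≈⟨ substitute-*ᵥ B x (substitute A (coords H)) j ⟩
      x * substitute B (substitute A (coords H)) j
        ≈⟨ *-congˡ (substitute-inverse {A} {B} AB≈1 (coords H) j) ⟩
      x * coords H j                                   ∎

  -- The trivial conditions on b and d give the product shape that `cardinality-subset-×` counts.
  P₃ : Pred Parameter ℓ
  P₃ (inj₁ _)                    = ⊥
  P₃ (inj₂ (inj₁ _))             = ⊥
  P₃ (inj₂ (inj₂ (b , d , e)))   = Polymorphic.⊤ {0ℓ} × Polymorphic.⊤ {0ℓ} × ¬ e ≈ 0#

  H₃⇒P₃ : ∀ p → H₃ (form-point p) → P₃ p
  H₃⇒P₃ p@(inj₁ r) f∈H₃ = contradiction (discriminant-form₁ r) (H₃⇒discriminant≉0 {form-point p} f∈H₃)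
  H₃⇒P₃ p@(inj₂ (inj₁ r)) f∈H₃ = contradiction (discriminant-form₂ r) (H₃⇒discriminant≉0 {form-point p} f∈H₃)
  H₃⇒P₃ p@(inj₂ (inj₂ (b , d , e))) f∈H₃ = _ , _ , λ e≈0 →
    H₃⇒discriminant≉0 {form-point p} f∈H₃ (trans (discriminant-form₃ b d e) e≈0)

  P₃⇒H₃ : ∀ p → P₃ p → H₃ (form-point p)
  P₃⇒H₃ p@(inj₂ (inj₂ (b , d , e))) (_ , _ , e≉0) = discriminant≉0⇒H₃ {form-point p} λ disc≈0 →
    e≉0 (trans (sym (discriminant-form₃ b d e)) disc≈0)

  -- Pairs of real lines

  H₂ᵣ-from-polar : ∀ {H u v i j} → coords H ≋ u ⊗ v → ¬ polar u v i j ≈ 0# → H₂ᵣ H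
  H₂ᵣ-from-polar {u = u} {v} {i} {j} H≋uv polar≉0 =
    (u , polar≉0⇒Nonzeroˡ {u = u} {v} {i} {j} polar≉0) ,
    (v , polar≉0⇒Nonzeroʳ {u = u} {v} {i} {j} polar≉0) ,
    polar≉0⇒≁ {u = u} {v} {i} {j} polar≉0 , H≋uv

  H₂ᵣ-invariant : Invariant H₂ᵣ
  H₂ᵣ-invariant A B x (AB≈1 , _) x≉0 H H′ H′≋xHA ((u , u≢0) , (v , v≢0) , u≁v , H≋uv) =
    -- `H₂ᵣ` carries no scalar, so x is absorbed into the first factor.
    (x *ᵥ uA , λ xuA≋0 → ᵥ*-Nonzero {A = A} {B} AB≈1 {u} u≢0 (λ j → integral x≉0 (xuA≋0 j))) ,
    (vA , ᵥ*-Nonzero {A = A} {B} AB≈1 {v} v≢0) ,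
    (λ xuA∼vA → u≁v (ᵥ*-∼ {A = A} {B} AB≈1 {u} {v} (∼-trans {u = uA} {x *ᵥ uA} {vA} uA∼xuA xuA∼vA))) ,
    λ j → begin
      coords H′ j
        ≈⟨ substitute-scaled-⊗ {A} {x} {1#} {coords H} {coords H′} {u} {v} H′≋xHA H≋1uv j ⟩
      x * 1# * (uA ⊗ vA) j      ≈⟨ *-congʳ (*-identityʳ x) ⟩
      x * (uA ⊗ vA) j           ≈⟨ scaled-⊗ x uA vA j ⟩
      ((x *ᵥ uA) ⊗ vA) j        ∎
    where
    uA vA : Vector Carrier 3
    uA = u ᵥ* A
    vA = v ᵥ* A
    uA∼xuA : uA ∼ x *ᵥ uA
    uA∼xuA = ∼-sym {v = x *ᵥ uA} {uA} (x , x≉0 , λ _ → refl)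
    H≋1uv : coords H ≋ 1# *ᵥ (u ⊗ v)
    H≋1uv j = trans (H≋uv j) (sym (*-identityˡ _))

  P₂ᵣ : Pred Parameter (c ⊔ ℓ)
  P₂ᵣ (inj₁ _)                  = ⊥
  P₂ᵣ (inj₂ (inj₁ (a , d)))     = ∈℘ (a * d)
  P₂ᵣ (inj₂ (inj₂ (b , d , e))) = Polymorphic.⊤ {0ℓ} × ∈℘ d × e ≈ 0#

  -- Without mixed terms the factors would be proportional. Otherwise u₀v₂ and u₂v₀ have sum 1 and
  -- product (u₀v₀)(u₂v₂) = ad; for `form₃` the indices 1 and 2 give the product 1 · d, and e
  -- vanishes as the discriminant of a product.
  H₂ᵣ⇒P₂ᵣ : ∀ p → H₂ᵣ (form-point p) → P₂ᵣ p
  H₂ᵣ⇒P₂ᵣ (inj₁ p) ((u , u≢0) , (v , v≢0) , u≁v , f≋uv) = contradiction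
    (polar≈0⇒∼ _≟_ {u = u} {v} u≢0 v≢0
      (⊗-polar≈0 u v (mixed≈0 p f≋uv .proj₁) (mixed≈0 p f≋uv .proj₂ .proj₁) (mixed≈0 p f≋uv .proj₂ .proj₂))) u≁v
    where
    mixed≈0 : ∀ p → form (inj₁ p) ≋ u ⊗ v → (u ⊗ v) 1F ≈ 0# × (u ⊗ v) 2F ≈ 0# × (u ⊗ v) 4F ≈ 0#
    mixed≈0 (inj₁ _) f≋uv = sym (f≋uv 1F) , sym (f≋uv 2F) , sym (f≋uv 4F)
    mixed≈0 (inj₂ _) f≋uv = sym (f≋uv 1F) , sym (f≋uv 2F) , sym (f≋uv 4F)
  H₂ᵣ⇒P₂ᵣ (inj₂ (inj₁ (a , d))) ((u , _) , (v , _) , _ , f≋uv) = u 0F * v 2F , (begin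
    ℘ (u 0F * v 2F)                      ≈⟨ ℘≈norm (sym (f≋uv 2F)) ⟩
    (u 0F * v 2F) * (u 2F * v 0F)
      ≈⟨ solve 4 (λ a b c d → (a :* b) :* (c :* d) := (a :* d) :* (c :* b)) refl (u 0F) (v 2F) (u 2F) (v 0F) ⟩
    (u 0F * v 0F) * (u 2F * v 2F)        ≈⟨ *-cong (f≋uv 0F) (f≋uv 5F) ⟨
    a * d                                ∎)
  H₂ᵣ⇒P₂ᵣ (inj₂ (inj₂ (b , d , e))) ((u , _) , (v , _) , _ , f≋uv) = _ , (u 1F * v 2F , (begin
    ℘ (u 1F * v 2F)                      ≈⟨ ℘≈norm (sym (f≋uv 4F)) ⟩
    (u 1F * v 2F) * (u 2F * v 1F)
      ≈⟨ solve 4 (λ a b c d → (a :* b) :* (c :* d) := (a :* d) :* (c :* b)) refl (u 1F) (v 2F) (u 2F) (v 1F) ⟩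
    (u 1F * v 1F) * (u 2F * v 2F)        ≈⟨ *-cong (f≋uv 3F) (f≋uv 5F) ⟨
    1# * d                               ≈⟨ *-identityˡ d ⟩
    d                                    ∎)) ,
    (begin
      e                                  ≈⟨ discriminant-form₃ b d e ⟨
      discriminant (form₃ (b , d , e))   ≈⟨ discriminant-cong {form₃ (b , d , e)} {u ⊗ v} f≋uv ⟩
      discriminant (u ⊗ v)               ≈⟨ discriminant-⊗ u v ⟩
      0#                                 ∎)

  P₂ᵣ⇒H₂ᵣ : ∀ p → P₂ᵣ p → H₂ᵣ (form-point p)
  P₂ᵣ⇒H₂ᵣ p@(inj₂ (inj₁ (a , d))) (s , ℘s≈ad) = by-cases (a ≟ 0#)
    where
    by-cases : Dec (a ≈ 0#) → H₂ᵣ (form-point p)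
    by-cases (yes a≈0) = H₂ᵣ-from-polar {form-point p} {0# ∷ 0# ∷ 1# ∷ []} {1# ∷ 0# ∷ d ∷ []} {0F} {2F} (form₂-factors₀ a≈0)
      (λ polar≈0 → 1≉0 (trans (form₂-factors₀ {a} {d} a≈0 2F) polar≈0))
    by-cases (no a≉0) = H₂ᵣ-from-polar {form-point p} {a⁻¹ *ᵥ u} {v} {0F} {2F} f≋uv
      λ polar≈0 → 1≉0 (trans (f≋uv 2F) polar≈0)
      where
      a⁻¹ = proj₁ (inverse a≉0)
      u v : Vector Carrier 3
      u = a ∷ 0# ∷ s ∷ []
      v = a ∷ 0# ∷ s + 1# ∷ []
      f≋uv : form p ≋ (a⁻¹ *ᵥ u) ⊗ v
      f≋uv j = trans (form₂-factors (proj₂ (inverse a≉0)) ℘s≈ad j) (scaled-⊗ a⁻¹ u v j)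
  P₂ᵣ⇒H₂ᵣ p@(inj₂ (inj₂ (b , d , e))) (_ , (s , ℘s≈d) , e≈0) =
    H₂ᵣ-from-polar {form-point p} {b + s ∷ 1# ∷ s ∷ []} {b + s + 1# ∷ 1# ∷ s + 1# ∷ []} {0F} {1F} (form₃-factors e≈0 ℘s≈d)
      λ polar≈0 → 1≉0 (trans (form₃-factors {b} e≈0 ℘s≈d 1F) polar≈0)

  -- Pairs of conjugate imaginary lines

  ⟦⟧-· : ∀ {n} (u v : Vector Carrier n) → ⟦ u · v ⟧ E.≈ map ⟦_⟧ u E.· map ⟦_⟧ v
  ⟦⟧-· {zero}  u v = 0#-homo
  ⟦⟧-· {suc n} u v = E.trans (+-homo _ _) (E.+-cong (*-homo (u 0F) (v 0F)) (⟦⟧-· (u ∘ suc) (v ∘ suc)))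

  ⟦⟧-⊗ : ∀ u v → map ⟦_⟧ (u ⊗ v) E.≋ map ⟦_⟧ u E.⊗ map ⟦_⟧ v
  ⟦⟧-⊗ u v = λ
    { 0F → *-homo (u 0F) (v 0F) ; 1F → mixed 0F 1F ; 2F → mixed 0F 2F
    ; 3F → *-homo (u 1F) (v 1F) ; 4F → mixed 1F 2F ; 5F → *-homo (u 2F) (v 2F) }
    where
    mixed : ∀ i j → ⟦ u i * v j + u j * v i ⟧ E.≈ ⟦ u i ⟧ E.* ⟦ v j ⟧ E.+ ⟦ u j ⟧ E.* ⟦ v i ⟧
    mixed i j = E.trans (+-homo _ _) (E.+-cong (*-homo (u i) (v j)) (*-homo (u j) (v i)))

  ⟦⟧-1ᴹ : ∀ {n} (i j : Fin n) → ⟦ 1ᴹ i j ⟧ E.≈ E.1ᴹ i j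
  ⟦⟧-1ᴹ 0F      0F      = 1#-homo
  ⟦⟧-1ᴹ 0F      (suc j) = 0#-homo
  ⟦⟧-1ᴹ (suc i) 0F      = 0#-homo
  ⟦⟧-1ᴹ (suc i) (suc j) = ⟦⟧-1ᴹ i j

  extend : Matrix 3 → E.Matrix 3
  extend = map (map ⟦_⟧)

  extend-inverse : ∀ {A B} → A *ᴹ B ≈ᴹ 1ᴹ → extend A E.*ᴹ extend B E.≈ᴹ E.1ᴹ
  extend-inverse {A} {B} AB≈1 i j =
    E.trans (E.sym (⟦⟧-· (A i) (λ k → B k j))) (E.trans (⟦⟧-cong (AB≈1 i j)) (⟦⟧-1ᴹ i j))

  ⟦⟧-substitute : ∀ A f → map ⟦_⟧ (substitute A f) E.≋ E.substitute (extend A) (map ⟦_⟧ f)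
  ⟦⟧-substitute A f j = E.trans (⟦⟧-· f (λ i → row-products A i j))
    (E.·-cong {u = map ⟦_⟧ f} {map ⟦_⟧ f} {λ i → ⟦ row-products A i j ⟧} {λ i → E.row-products (extend A) i j}
      (λ _ → E.refl) λ
        { 0F → ⟦⟧-⊗ (A 0F) (A 0F) j ; 1F → ⟦⟧-⊗ (A 0F) (A 1F) j ; 2F → ⟦⟧-⊗ (A 0F) (A 2F) j
        ; 3F → ⟦⟧-⊗ (A 1F) (A 1F) j ; 4F → ⟦⟧-⊗ (A 1F) (A 2F) j ; 5F → ⟦⟧-⊗ (A 2F) (A 2F) j })

  σ-0 : σ E.0# E.≈ E.0#
  σ-0 = E.trans (σ-cong (E.sym 0#-homo)) (E.trans (σ-⟦⟧ 0#) 0#-homo)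

  σ-1 : σ E.1# E.≈ E.1#
  σ-1 = E.trans (σ-cong (E.sym 1#-homo)) (E.trans (σ-⟦⟧ 1#) 1#-homo)

  σ-· : ∀ {n} (u v : Vector E.Carrier n) → σ (u E.· v) E.≈ map σ u E.· map σ v
  σ-· {zero}  u v = σ-0
  σ-· {suc n} u v = E.trans (σ-+ _ _) (E.+-cong (σ-* (u 0F) (v 0F)) (σ-· (u ∘ suc) (v ∘ suc)))

  -- The entries of `extend A` come from `F`, so `σ` fixes them.
  σ-ᵥ* : ∀ u A → map σ (u E.ᵥ* extend A) E.≋ map σ u E.ᵥ* extend A
  σ-ᵥ* u A j = E.trans (σ-· u (λ i → ⟦ A i j ⟧))
    (E.·-cong {u = map σ u} {map σ u} {λ i → σ ⟦ A i j ⟧} {λ i → ⟦ A i j ⟧} (λ _ → E.refl) (λ i → σ-⟦⟧ (A i j)))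

  H₂ᵢ-invariant : Invariant H₂ᵢ
  H₂ᵢ-invariant A B x (AB≈1 , _) x≉0 H H′ H′≋xHA (y , (u , u≢0) , u≁σu , H≋yuσu) =
    x * y , (uA , E.ᵥ*-Nonzero {A = extend A} {extend B} (extend-inverse {A} {B} AB≈1) {u} u≢0) ,
    (λ uA∼σuA → u≁σu (E.ᵥ*-∼ {A = extend A} {extend B} (extend-inverse {A} {B} AB≈1) {u} {map σ u}
      (E.∼-trans {u = uA} {map σ uA} {σuA} uA∼σuA (E.1# , E.1≉0 , λ j → E.trans (σ-ᵥ* u A j) (E.sym (E.*-identityˡ _)))))) ,
    λ j → E.begin
      ⟦ coords H′ j ⟧
        E.≈⟨ E.substitute-scaled-⊗ {extend A} {⟦ x ⟧} {⟦ y ⟧} {map ⟦_⟧ (coords H)} {map ⟦_⟧ (coords H′)} {u} {map σ u} H′≋ H≋yuσu j ⟩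
      ⟦ x ⟧ E.* ⟦ y ⟧ E.* (uA E.⊗ σuA) j
        E.≈⟨ E.*-cong (*-homo x y) (E.⊗-cong {uA} {uA} {map σ uA} {σuA} (λ _ → E.refl) (σ-ᵥ* u A) j) ⟨
      ⟦ x * y ⟧ E.* (uA E.⊗ map σ uA) j                E.∎
    where
    uA σuA : Vector E.Carrier 3
    uA = u E.ᵥ* extend A
    σuA = map σ u E.ᵥ* extend A
    H′≋ : map ⟦_⟧ (coords H′) E.≋ ⟦ x ⟧ E.*ᵥ E.substitute (extend A) (map ⟦_⟧ (coords H))
    H′≋ j = E.trans (⟦⟧-cong (H′≋xHA j)) (E.trans (*-homo x _) (E.*-congˡ (⟦⟧-substitute A (coords H) j)))

  P₂ᵢ : Pred Parameter (c ⊔ ℓ)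
  P₂ᵢ (inj₁ _)                  = ⊥
  P₂ᵢ (inj₂ (inj₁ (a , d)))     = ¬ ∈℘ (a * d)
  P₂ᵢ (inj₂ (inj₂ (b , d , e))) = Polymorphic.⊤ {0ℓ} × ¬ ∈℘ d × e ≈ 0#

  ⟦⟧-discriminant : ∀ f → ⟦ discriminant f ⟧ E.≈ E.discriminant (map ⟦_⟧ f)
  ⟦⟧-discriminant f = E.trans (⟦⟧-· f (squares (nucleus f)))
    (E.·-cong {u = map ⟦_⟧ f} {map ⟦_⟧ f} {map ⟦_⟧ (squares (nucleus f))} {E.squares (E.nucleus (map ⟦_⟧ f))}
      (λ _ → E.refl) λ
        { 0F → *-homo _ _ ; 1F → *-homo _ _ ; 2F → *-homo _ _ ; 3F → *-homo _ _ ; 4F → *-homo _ _ ; 5F → *-homo _ _ })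

  -- The two summands of a mixed coefficient of x (u ⊗ σ u) are conjugate.
  module ConjugateFactors {f : Vector Carrier 6} {x : Carrier} {u : Vector E.Carrier 3}
    (f≋ : map ⟦_⟧ f E.≋ ⟦ x ⟧ E.*ᵥ (u E.⊗ map σ u)) where

    half : Fin 3 → Fin 3 → E.Carrier
    half i j = ⟦ x ⟧ E.* (u i E.* σ (u j))

    σ-half : ∀ i j → σ (half i j) E.≈ half j i
    σ-half i j = E.begin
      σ (⟦ x ⟧ E.* (u i E.* σ (u j)))          E.≈⟨ E.trans (σ-* _ _) (E.*-congˡ (σ-* _ _)) ⟩
      σ ⟦ x ⟧ E.* (σ (u i) E.* σ (σ (u j)))    E.≈⟨ E.*-cong (σ-⟦⟧ x) (E.*-congˡ (σ-involutive (u j))) ⟩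
      ⟦ x ⟧ E.* (σ (u i) E.* u j)              E.≈⟨ E.*-congˡ (E.*-comm _ _) ⟩
      ⟦ x ⟧ E.* (u j E.* σ (u i))              E.∎

    -- `half i j` has trace 1, and its norm is `half i i` times `half j j`, so `norm∉℘` applies.
    mixed∉℘ : ∀ {i j y z} → ⟦ 1# ⟧ E.≈ ⟦ x ⟧ E.* (u i E.* σ (u j) E.+ u j E.* σ (u i)) →
      ⟦ y ⟧ E.≈ half i i → ⟦ z ⟧ E.≈ half j j → ¬ ∈℘ (y * z)
    mixed∉℘ {i} {j} {y} {z} trace yᵢ zⱼ = norm∉℘ {half i j}
      (E.begin
        half i j E.+ σ (half i j)                                  E.≈⟨ E.+-congˡ (σ-half i j) ⟩
        half i j E.+ half j i                                      E.≈⟨ E.distribˡ _ _ _ ⟨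
        ⟦ x ⟧ E.* (u i E.* σ (u j) E.+ u j E.* σ (u i))            E.≈⟨ trace ⟨
        ⟦ 1# ⟧                                                     E.≈⟨ 1#-homo ⟩
        E.1#                                                       E.∎)
      (E.begin
        half i j E.* σ (half i j)  E.≈⟨ E.*-congˡ (σ-half i j) ⟩
        half i j E.* half j i      E.≈⟨ E.solve 5 (λ x a b c d →
          x E.:* (a E.:* d) E.:* (x E.:* (c E.:* b)) E.:= x E.:* (a E.:* b) E.:* (x E.:* (c E.:* d)))
          E.refl ⟦ x ⟧ (u i) (σ (u i)) (u j) (σ (u j)) ⟩
        half i i E.* half j j      E.≈⟨ E.*-cong yᵢ zⱼ ⟨
        ⟦ y ⟧ E.* ⟦ z ⟧            E.≈⟨ *-homo y z ⟨
        ⟦ y * z ⟧                  E.∎)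

    discriminant≈0 : discriminant f ≈ 0#
    discriminant≈0 = ⟦⟧≈0 (E.begin
      ⟦ discriminant f ⟧                             E.≈⟨ ⟦⟧-discriminant f ⟩
      E.discriminant (map ⟦_⟧ f)
        E.≈⟨ E.discriminant-cong {map ⟦_⟧ f} {⟦ x ⟧ E.*ᵥ (u E.⊗ map σ u)} f≋ ⟩
      E.discriminant (⟦ x ⟧ E.*ᵥ (u E.⊗ map σ u))    E.≈⟨ E.discriminant-*ᵥ ⟦ x ⟧ (u E.⊗ map σ u) ⟩
      ⟦ x ⟧ E.* ⟦ x ⟧ E.* ⟦ x ⟧ E.* E.discriminant (u E.⊗ map σ u)
        E.≈⟨ E.*-congˡ (E.discriminant-⊗ u (map σ u)) ⟩
      ⟦ x ⟧ E.* ⟦ x ⟧ E.* ⟦ x ⟧ E.* E.0#             E.≈⟨ E.zeroʳ _ ⟩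
      E.0#                                           E.∎)

    x≉0 : Nonzero f → ¬ ⟦ x ⟧ E.≈ E.0#
    x≉0 f≢0 x≈0 = f≢0 λ i → ⟦⟧≈0 (E.trans (f≋ i) (E.trans (E.*-congʳ x≈0) (E.zeroˡ _)))

    mixed≈0 : Nonzero f → ∀ k → f k ≈ 0# → (u E.⊗ map σ u) k E.≈ E.0#
    mixed≈0 f≢0 k fₖ≈0 = E.integral (x≉0 f≢0) (E.trans (E.sym (f≋ k)) (E.trans (⟦⟧-cong fₖ≈0) 0#-homo))

  H₂ᵢ⇒P₂ᵢ : ∀ p → H₂ᵢ (form-point p) → P₂ᵢ p
  H₂ᵢ⇒P₂ᵢ (inj₁ p) (x , (u , u≢0) , u≁σu , f≋) = contradiction
    (E.polar≈0⇒∼ E._≟_ {u = u} {map σ u} u≢0 σu≢0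
      (E.⊗-polar≈0 u (map σ u)
        (mixed≈0′ 1F (mixed p .proj₁)) (mixed≈0′ 2F (mixed p .proj₂ .proj₁)) (mixed≈0′ 4F (mixed p .proj₂ .proj₂))))
    u≁σu
    where
    open ConjugateFactors {form (inj₁ p)} {x} {u} f≋
    mixed≈0′ = mixed≈0 (form-Nonzero (inj₁ p))
    mixed : ∀ p → form (inj₁ p) 1F ≈ 0# × form (inj₁ p) 2F ≈ 0# × form (inj₁ p) 4F ≈ 0#
    mixed (inj₁ _) = refl , refl , refl
    mixed (inj₂ _) = refl , refl , refl
    σu≢0 : E.Nonzero (map σ u)
    σu≢0 σu≋0 = u≢0 λ i → E.trans (E.sym (σ-involutive (u i))) (E.trans (σ-cong (σu≋0 i)) σ-0)
  H₂ᵢ⇒P₂ᵢ p@(inj₂ (inj₁ (a , d))) (x , (u , _) , _ , f≋) = mixed∉℘ {0F} {2F} (f≋ 2F) (f≋ 0F) (f≋ 5F)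
    where open ConjugateFactors {form p} {x} {u} f≋
  H₂ᵢ⇒P₂ᵢ p@(inj₂ (inj₂ (b , d , e))) (x , (u , _) , _ , f≋) =
    _ , (λ d∈℘ → mixed∉℘ {1F} {2F} (f≋ 4F) (f≋ 3F) (f≋ 5F) (∈℘-resp (sym (*-identityˡ d)) d∈℘)) ,
    trans (sym (discriminant-form₃ b d e)) discriminant≈0
    where open ConjugateFactors {form p} {x} {u} f≋

  -- w is the conjugate of u in explicit form, with s + 1 for `σ s`, the shape in which
  -- `form₂-factors` and `form₃-factors` deliver the second factor.
  H₂ᵢ-from-polar : ∀ {H : Hyperplane} {x u w i j} → map ⟦_⟧ (coords H) E.≋ ⟦ x ⟧ E.*ᵥ (u E.⊗ w) → map σ u E.≋ w →
    ¬ E.polar u w i j E.≈ E.0# → H₂ᵢ H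
  H₂ᵢ-from-polar {H} {x} {u} {w} {i} {j} H≋ σu≋w polar≉0 =
    x , (u , E.polar≉0⇒Nonzeroˡ {u = u} {w} {i} {j} polar≉0) ,
    (λ u∼σu → E.polar≉0⇒≁ {u = u} {w} {i} {j} polar≉0
      (E.∼-trans {u = u} {map σ u} {w} u∼σu (E.1# , E.1≉0 , λ k → E.trans (σu≋w k) (E.sym (E.*-identityˡ _))))) ,
    λ k → E.trans (H≋ k) (E.*-congˡ (E.sym (E.⊗-cong {u} {u} {map σ u} {w} (λ _ → E.refl) σu≋w k)))

  P₂ᵢ⇒H₂ᵢ : ∀ p → P₂ᵢ p → H₂ᵢ (form-point p)
  P₂ᵢ⇒H₂ᵢ p@(inj₂ (inj₁ (a , d))) ad∉℘ = H₂ᵢ-from-polar {form-point p} {a⁻¹} {u} {w} {0F} {2F} f≋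
    (λ { 0F → σ-⟦⟧ a ; 1F → σ-0 ; 2F → proj₁ (proj₂ (conjugate-roots ad∉℘)) })
    λ polar≈0 → E.1≉0 (E.trans (E.sym 1#-homo) (E.trans (f≋ 2F) (E.trans (E.*-congˡ polar≈0) (E.zeroʳ _))))
    where
    -- For a = 0 the product ad would be 0, which is `℘ 0#`.
    a≉0 : ¬ a ≈ 0#
    a≉0 a≈0 = ad∉℘ (0# , trans (solve 0 (con false :* con false :+ con false := con false) refl)
      (trans (sym (zeroˡ d)) (*-congʳ (sym a≈0))))
    a⁻¹ = proj₁ (inverse a≉0)
    s = proj₁ (conjugate-roots ad∉℘)
    u w : Vector E.Carrier 3
    u = ⟦ a ⟧ ∷ E.0# ∷ s ∷ []
    w = ⟦ a ⟧ ∷ E.0# ∷ s E.+ E.1# ∷ []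
    f≋ : map ⟦_⟧ (form p) E.≋ ⟦ a⁻¹ ⟧ E.*ᵥ (u E.⊗ w)
    f≋ k = E.trans (⟦⟧-form₂ k) (E.form₂-factors
      (E.trans (E.sym (*-homo a⁻¹ a)) (E.trans (⟦⟧-cong (proj₂ (inverse a≉0))) 1#-homo))
      (E.trans (proj₂ (proj₂ (conjugate-roots ad∉℘))) (*-homo a d)) k)
      where
      ⟦⟧-form₂ : map ⟦_⟧ (form₂ (a , d)) E.≋ E.form₂ (⟦ a ⟧ , ⟦ d ⟧)
      ⟦⟧-form₂ = λ { 0F → E.refl ; 1F → 0#-homo ; 2F → 1#-homo ; 3F → 0#-homo ; 4F → 0#-homo ; 5F → E.refl }
  P₂ᵢ⇒H₂ᵢ p@(inj₂ (inj₂ (b , d , e))) (_ , d∉℘ , e≈0) = H₂ᵢ-from-polar {form-point p} {1#} {u} {w} {0F} {1F} f≋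
    (λ { 0F → E.trans (σ-+ ⟦ b ⟧ s) (E.trans (E.+-cong (σ-⟦⟧ b) σs≈s+1) (E.sym (E.+-assoc ⟦ b ⟧ s E.1#)))
       ; 1F → σ-1 ; 2F → σs≈s+1 })
    λ polar≈0 → E.1≉0 (E.trans (E.sym 1#-homo) (E.trans (f≋ 1F) (E.trans (E.*-congˡ polar≈0) (E.zeroʳ _))))
    where
    s = proj₁ (conjugate-roots d∉℘)
    σs≈s+1 : σ s E.≈ s E.+ E.1#
    σs≈s+1 = proj₁ (proj₂ (conjugate-roots d∉℘))
    u w : Vector E.Carrier 3
    u = ⟦ b ⟧ E.+ s ∷ E.1# ∷ s ∷ []
    w = ⟦ b ⟧ E.+ s E.+ E.1# ∷ E.1# ∷ s E.+ E.1# ∷ []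
    f≋ : map ⟦_⟧ (form p) E.≋ ⟦ 1# ⟧ E.*ᵥ (u E.⊗ w)
    f≋ k = E.trans (⟦⟧-form₃ k) (E.trans
      (E.form₃-factors {b = ⟦ b ⟧} (E.trans (⟦⟧-cong e≈0) 0#-homo) (proj₂ (proj₂ (conjugate-roots d∉℘))) k)
      (E.trans (E.sym (E.*-identityˡ _)) (E.*-congʳ (E.sym 1#-homo))))
      where
      ⟦⟧-form₃ : map ⟦_⟧ (form₃ (b , d , e)) E.≋ E.form₃ (⟦ b ⟧ , ⟦ d ⟧ , ⟦ e ⟧)
      ⟦⟧-form₃ = λ
        { 0F → E.trans (+-homo _ e) (E.+-congʳ (E.trans (+-homo _ d)
            (E.+-congʳ (E.trans (+-homo _ b) (E.+-congʳ (*-homo b b))))))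
        ; 1F → 1#-homo ; 2F → E.refl ; 3F → 1#-homo ; 4F → 1#-homo ; 5F → E.refl }

  -- Counting the parameters

  private
    k : ℕ
    k = 2 ℕ.^ m

    pairs : Setoid c ℓ
    pairs = setoid ×ₛ setoid

    |pairs| : pairs HasCardinality (q ℕ.* q)
    |pairs| = cardinality-× |F| |F|

    |F|ᵁ : Subsetoid setoid (λ _ → Polymorphic.⊤ {0ℓ}) HasCardinality q
    |F|ᵁ = cardinality-subset-U _ |F|

    0∈℘ : ∈℘ 0#
    0∈℘ = 0# , solve 0 (con false :* con false :+ con false := con false) refl

  -- Such a pair has a ≠ 0 and corresponds to (a, y) with y = ad, d being recovered as y divided by
  -- a.
  |products∉℘| : Subsetoid pairs (λ (a , d) → ¬ ∈℘ (a * d)) HasCardinality ((q ℕ.∸ 1) ℕ.* k)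
  |products∉℘| = cardinality-↔ {S = source} {target} (bijection⇒inverse to
      (λ {x} {y} → cong {x} {y}) (λ {x} {y} → injective {x} {y}) surjective)
    (cardinality-× |Nonzero#| |∉℘|)
    where
    source : Setoid _ _
    source = Subsetoid setoid Nonzero# ×ₛ Subsetoid setoid (¬_ ∘ ∈℘)
    target : Setoid _ _
    target = Subsetoid pairs λ (a , d) → ¬ ∈℘ (a * d)
    module _ {a} (a≉0 : Nonzero# a) where
      divide : Carrier → Carrier
      divide y = proj₁ (inverse a≉0) * y
      *-divide : ∀ y → a * divide y ≈ y
      *-divide y = begin
        a * (a⁻¹ * y)  ≈⟨ *-assoc a a⁻¹ y ⟨
        a * a⁻¹ * y    ≈⟨ *-congʳ (trans (*-comm a a⁻¹) (proj₂ (inverse a≉0))) ⟩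
        1# * y         ≈⟨ *-identityˡ y ⟩
        y              ∎
        where a⁻¹ = proj₁ (inverse a≉0)
    to : Setoid.Carrier source → Setoid.Carrier target
    to ((a , a≉0) , (y , y∉℘)) = (a , divide a≉0 y) , y∉℘ ∘ ∈℘-resp (*-divide a≉0 y)
    cong : Congruent (Setoid._≈_ source) (Setoid._≈_ target) to
    cong {(a , a≉0) , (y , _)} {(b , b≉0) , (z , _)} (a≈b , y≈z) = a≈b , *-cancelˡ a≉0 (begin
      a * divide a≉0 y  ≈⟨ *-divide a≉0 y ⟩
      y                 ≈⟨ y≈z ⟩
      z                 ≈⟨ *-divide b≉0 z ⟨
      b * divide b≉0 z  ≈⟨ *-congʳ a≈b ⟨
      a * divide b≉0 z  ∎)
    injective : Injective (Setoid._≈_ source) (Setoid._≈_ target) to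
    injective {(a , a≉0) , (y , _)} {(b , b≉0) , (z , _)} (a≈b , y/a≈z/b) = a≈b , (begin
      y                 ≈⟨ *-divide a≉0 y ⟨
      a * divide a≉0 y  ≈⟨ *-cong a≈b y/a≈z/b ⟩
      b * divide b≉0 z  ≈⟨ *-divide b≉0 z ⟩
      z                 ∎)
    surjective : StrictlySurjective (Setoid._≈_ target) to
    surjective ((a , d) , ad∉℘) = ((a , a≉0) , (a * d , ad∉℘)) , refl , *-cancelˡ a≉0 (*-divide a≉0 (a * d))
      where
      a≉0 : Nonzero# a
      a≉0 a≈0 = ad∉℘ (∈℘-resp (trans (sym (zeroˡ d)) (*-congʳ (sym a≈0))) 0∈℘)

  -- Counted as a complement, since for a = 0 the value ad does not determine d.
  |products∈℘| : Subsetoid pairs (λ (a , d) → ∈℘ (a * d)) HasCardinality (q ℕ.* q ℕ.∸ (q ℕ.∸ 1) ℕ.* k)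
  |products∈℘| = cardinality-subset-≐ ((λ {(a , d)} → decidable-stable (∈℘? (a * d))) , λ ad∈℘ ad∉℘ → ad∉℘ ad∈℘)
    (Finite.complement-cardinality |pairs|
      (λ (a≈a′ , d≈d′) ad∉℘ → ad∉℘ ∘ ∈℘-resp (*-cong (sym a≈a′) (sym d≈d′)))
      (λ (a , d) → ¬? (∈℘? (a * d))) |products∉℘|)

  |P₁| : Subsetoid parameters P₁ HasCardinality (q ℕ.+ 1 ℕ.+ 0)
  |P₁| = cardinality-subset-⊎ {P = P₁} (cardinality-subset-U _ (cardinality-⊎ |F| cardinality-⊤)) (cardinality-∅ λ _ ())

  |P₂ᵣ| : Subsetoid parameters P₂ᵣ HasCardinality (0 ℕ.+ ((q ℕ.* q ℕ.∸ (q ℕ.∸ 1) ℕ.* k) ℕ.+ q ℕ.* (k ℕ.* 1)))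
  |P₂ᵣ| = cardinality-subset-⊎ {P = P₂ᵣ} (cardinality-∅ λ _ ())
    (cardinality-subset-⊎ {P = P₂ᵣ ∘ inj₂} |products∈℘| (cardinality-subset-× |F|ᵁ (cardinality-subset-× |∈℘| |0#|)))

  |P₂ᵢ| : Subsetoid parameters P₂ᵢ HasCardinality (0 ℕ.+ ((q ℕ.∸ 1) ℕ.* k ℕ.+ q ℕ.* (k ℕ.* 1)))
  |P₂ᵢ| = cardinality-subset-⊎ {P = P₂ᵢ} (cardinality-∅ λ _ ())
    (cardinality-subset-⊎ {P = P₂ᵢ ∘ inj₂} |products∉℘| (cardinality-subset-× |F|ᵁ (cardinality-subset-× |∉℘| |0#|)))

  |P₃| : Subsetoid parameters P₃ HasCardinality (0 ℕ.+ (0 ℕ.+ q ℕ.* (q ℕ.* (q ℕ.∸ 1))))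
  |P₃| = cardinality-subset-⊎ {P = P₃} (cardinality-∅ λ _ ())
    (cardinality-subset-⊎ {P = P₃ ∘ inj₂} (cardinality-∅ λ _ ())
      (cardinality-subset-× |F|ᵁ (cardinality-subset-× |F|ᵁ |Nonzero#|)))

  open Totals {k = k} q≡2^m+2^m 1≤order
  open HyperplaneOrbits q F E ι using (OD₄[_]=[_,_,_,_])

  distribution : (L : Line 5) → L ∈ o₁₂,₃ →
    OD₄[ L ]=[ q ℕ.+ 1 , q ℕ.^ 2 ℕ.+ q ℕ./ 2 , q ℕ.^ 2 ℕ.∸ q ℕ./ 2 , q ℕ.^ 3 ℕ.∸ q ℕ.^ 2 ]
  distribution L (A , (B , BA≈1 , AB≈1) , L≐) = record
    { number₁  = ≡.subst (Subsetoid (PG 5) (λ H → H₁ H × H ∈ Contains L) HasCardinality_) (ℕ.+-identityʳ (q ℕ.+ 1))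
        (count {𝓗 = H₁} {P₁} H₁-invariant H₁⇒P₁ P₁⇒H₁ |P₁|)
    ; number₂ᵣ = ≡.subst (Subsetoid (PG 5) (λ H → H₂ᵣ H × H ∈ Contains L) HasCardinality_) total₂ᵣ
        (count {𝓗 = H₂ᵣ} {P₂ᵣ} H₂ᵣ-invariant H₂ᵣ⇒P₂ᵣ P₂ᵣ⇒H₂ᵣ |P₂ᵣ|)
    ; number₂ᵢ = ≡.subst (Subsetoid (PG 5) (λ H → H₂ᵢ H × H ∈ Contains L) HasCardinality_) total₂ᵢ
        (count {𝓗 = H₂ᵢ} {P₂ᵢ} H₂ᵢ-invariant H₂ᵢ⇒P₂ᵢ P₂ᵢ⇒H₂ᵢ |P₂ᵢ|)
    ; number₃  = ≡.subst (Subsetoid (PG 5) (λ H → H₃ H × H ∈ Contains L) HasCardinality_) total₃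
        (count {𝓗 = H₃} {P₃} H₃-invariant H₃⇒P₃ P₃⇒H₃ |P₃|)
    }
    where
    count : ∀ {h r n} {𝓗 : Pred Hyperplane h} {P : Pred Parameter r} → Invariant 𝓗 →
      (∀ p → 𝓗 (form-point p) → P p) → (∀ p → P p → 𝓗 (form-point p)) →
      Subsetoid parameters P HasCardinality n → Subsetoid (PG 5) (λ H → 𝓗 H × H ∈ Contains L) HasCardinality n
    count {𝓗 = 𝓗} {P} = number-containing L {A} {B} (AB≈1 , BA≈1) L≐ {𝓗 = 𝓗} {P}

-- Euclid's lemma brings 2 ∣ p^k down to 2 ∣ p, and a prime divisible by 2 is 2.
even-prime-power : ∀ {q} → EvenPrimePower q → ∃ λ m → q ≡ 2 ℕ.^ suc m
even-prime-power ((p , zero , _ , () , _) , _)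
even-prime-power {q} ((p , suc m , p-prime , _ , q≡p^1+m) , 2∣q) =
  m , ≡.trans q≡p^1+m (≡.cong (ℕ._^ suc m) (≡.sym (prime∣prime (suc m) (≡.subst (2 ∣_) q≡p^1+m 2∣q))))
  where
  prime∣prime : ∀ k → 2 ∣ p ℕ.^ k → 2 ≡ p
  prime∣prime zero    2∣1 = contradiction (∣1⇒≡1 2∣1) λ ()
  prime∣prime (suc k) 2∣p^1+k with euclidsLemma p (p ℕ.^ k) prime[2] 2∣p^1+k
  ... | inj₂ 2∣p^k = prime∣prime k 2∣p^k
  ... | inj₁ 2∣p with prime⇒irreducible p-prime 2∣p
  ... | inj₂ 2≡p = 2≡p

open import Data.Nat.Base using (ℕ; _+_; _∸_; _^_; _/_)

lemma4p10 : ∀ {c ℓ c′ ℓ′ : Level} (q : ℕ) → EvenPrimePower q →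
    (F : Field c ℓ) → Field.setoid F HasCardinality q →
    (E : Field c′ ℓ′) → Field.setoid E HasCardinality (q ^ 2) →
    (ι : RingHomomorphism (Field.rawRing F) (Field.rawRing E)) →
    (L : Projective.Line F 5) → L ∈ Projective.o₁₂,₃ F →
    let open HyperplaneOrbits q F E ι in
    OD₄[ L ]=[ q + 1 , q ^ 2 + q / 2 , q ^ 2 ∸ q / 2 , q ^ 3 ∸ q ^ 2 ]
lemma4p10 q q-even F |F| E |E| ι =
  let m , q≡2^1+m = even-prime-power q-even
  in HyperplaneClasses.distribution {m = m} q≡2^1+m F |F| E |E| ι
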